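{- Let $n\ge 1$ and let $A\in\mathcal{E}_n$ have rank $r$ (as an abelian group). Then there exists a finite set $E$ of mod-linear functions $l:\mathbb{Z}^{2n}\to\mathbb{Z}$ of order $\le r$ such that for all integers $a_1\le b_1,\dots,a_n\le b_n$ the following are equivalent: (i) there exists $(x_1,\dots,x_n)\in A$ with $a_i\le x_i\le b_i$ for all $i=1,\dots,n$; (ii) $0\le l(a_1,b_1,a_2,b_2,\dots,a_n,b_n)$ for every $l\in E$.
   Context: For $v=(v_1,\dots,v_n),w=(w_1,\dots,w_n)\in\mathbb{Z}^n$ write $v\mid w$ if $v_i$ divides $w_i$ for every $i$ with $v_i\neq 0$. For $v\in\mathbb{Q}^n$ with support $S=\{i: v_i\neq 0\}$ of size $s$, define the linear map $L_v:\mathbb{Q}^n\to\mathbb{Q}^{\binom{s}{2}+n-s}$ by $L_v(t_1,\dots,t_n)=\big((\tfrac{t_i}{v_i}-\tfrac{t_j}{v_j})_{i<j,\ i,j\in S},\ (t_k)_{k\notin S}\big)$, where the pairs $(i,j)$ are listed in lexicographic order and then the $t_k$, $k\notin S$, in increasing order of $k$. The class $\mathcal{E}_n$ of subgroups of $\mathbb{Z}^n$ is defined inductively: a nonzero subgroup $A\subseteq\mathbb{Z}^n$ belongs to $\mathcal{E}_n$ iff there is a nonzero $v\in A$ with (1) $v\mid w$ for all $w\in A$, and (2) $L_v(A)=\{0\}$ or $L_v(A)\in\mathcal{E}_{\binom{s}{2}+n-s}$ (where $s$ is the number of nonzero components of $v$; under (1), $L_v(A)\subseteq\mathbb{Z}^{\binom{s}{2}+n-s}$).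 Mod-linear functions $l:\mathbb{Z}^N\to\mathbb{Z}$ of order $\le r$ are defined inductively: those of order $\le 0$ are the coordinate projections $(x_1,\dots,x_N)\mapsto x_i$; for $r>0$, $l$ has order $\le r$ if there are mod-linear functions $l_1,l_2$ of order $\le r-1$ and nonzero integers $m_1,m_2$ with $l(x)=\lfloor l_1(x)/m_1\rfloor-\lceil l_2(x)/m_2\rceil$ for all $x\in\mathbb{Z}^N$. -}

module Defs where

open import Data.Fin.Base using (Fin)
open import Data.Integer.Base as ℤ using (ℤ; 0ℤ)
open import Data.Integer.Divisibility using (_∣_)
open import Data.List.Base as List using (List; []; _∷_; _++_; length; filter; allFin)
open import Data.List.Properties using (length-++; length-map; length-tabulate)
open import Data.Nat.Base as ℕ using (ℕ; zero; suc)
open import Data.Nat.Combinatorics using (_C_; nC1≡n; nCk+nC[k+1]≡[n+1]C[k+1])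
import Data.Nat.Properties as ℕ
open import Data.Product.Base using (_×_; _,_; ∃; Σ-syntax)
open import Data.Rational.Base as ℚ using (ℚ; 0ℚ; ≢-nonZero; floor; ceiling)
import Data.Rational.Properties as ℚ
open import Data.Sum.Base using (_⊎_)
open import Data.Vec.Base as Vec using (Vec; []; _∷_; lookup; replicate; zipWith)
open import Data.Vec.Relation.Unary.All using (All)
open import Level using (Level)
open import Relation.Binary.PropositionalEquality
  using (_≡_; _≢_; refl; sym; trans; cong; cong₂; module ≡-Reasoning)
open import Relation.Nullary using (¬_; yes; no; ¬?)
open import Relation.Unary using (Pred; Decidable; _∈_)

private
  variable
    ℓ : Level
    n : ℕ

infix  4 _∣ᵛ_
infixl 6 _⊕_
infixr 7 _·_
infixl 7 _⟋_

-- Division on ℚ made total by p ⟋ 0 = 0; below it is only ever applied to a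
-- non-zero denominator.
_⟋_ : ℚ → ℚ → ℚ
p ⟋ q with q ℚ.≟ 0ℚ
... | yes _   = 0ℚ
... | no q≢0 = (p ℚ.÷ q) {{≢-nonZero q≢0}}

fromℤ : ℤ → ℚ
fromℤ z = z ℚ./ 1

_⊕_ : Vec ℤ n → Vec ℤ n → Vec ℤ n
_⊕_ = zipWith ℤ._+_

⊖_ : Vec ℤ n → Vec ℤ n
⊖_ = Vec.map (ℤ.-_)

_·_ : ℤ → Vec ℤ n → Vec ℤ n
c · v = Vec.map (c ℤ.*_) v

𝟘 : Vec ℤ n
𝟘 = replicate _ 0ℤ

record IsSubgroup {n : ℕ} (A : Pred (Vec ℤ n) ℓ) : Set ℓ where
  field
    𝟘-mem    : 𝟘 ∈ A
    ⊕-closed : ∀ {x y} → x ∈ A → y ∈ A → x ⊕ y ∈ A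
    ⊖-closed : ∀ {x} → x ∈ A → ⊖ x ∈ A

combination : ∀ {k} → Vec ℤ k → Vec (Vec ℤ n) k → Vec ℤ n
combination []       []       = 𝟘
combination (c ∷ cs) (w ∷ ws) = (c · w) ⊕ combination cs ws

Independent : ∀ {k} → Vec (Vec ℤ n) k → Set
Independent ws = ∀ cs → combination cs ws ≡ 𝟘 → cs ≡ 𝟘

-- The rank of an abelian group: the maximal number of ℤ-independent elements.
HasRank : Pred (Vec ℤ n) ℓ → ℕ → Set ℓ
HasRank {n = n} A r =
  (Σ[ ws ∈ Vec (Vec ℤ n) r ] All A ws × Independent ws) ×
  (∀ (ws : Vec (Vec ℤ n) (suc r)) → All A ws → ¬ Independent ws)

_∣ᵛ_ : Vec ℤ n → Vec ℤ n → Set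
v ∣ᵛ w = ∀ i → lookup v i ≢ 0ℤ → lookup v i ∣ lookup w i

zero? : (v : Vec ℚ n) → Decidable (λ i → lookup v i ≡ 0ℚ)
zero? v i = lookup v i ℚ.≟ 0ℚ

support : Vec ℚ n → List (Fin n)
support v = filter (λ i → ¬? (zero? v i)) (allFin _)

cosupport : Vec ℚ n → List (Fin n)
cosupport v = filter (zero? v) (allFin _)

-- On an increasing list: the pairs (i , j) with i < j, in lexicographic order.
pairs : ∀ {a} {X : Set a} → List X → List (X × X)
pairs []       = []
pairs (x ∷ xs) = List.map (x ,_) xs ++ pairs xs

L-entries : Vec ℚ n → Vec ℚ n → List ℚ
L-entries v t =
  List.map (λ (i , j) → (lookup t i ⟋ lookup v i) ℚ.- (lookup t j ⟋ lookup v j))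
           (pairs (support v))
  ++ List.map (lookup t) (cosupport v)

dimL : Vec ℚ n → ℕ
dimL {n} v = (s C 2) ℕ.+ (n ℕ.∸ s)
  where s = length (support v)

length-pairs : ∀ {a} {X : Set a} (xs : List X) → length (pairs xs) ≡ length xs C 2
length-pairs []       = refl
length-pairs (x ∷ xs) = begin
  length (List.map (x ,_) xs ++ pairs xs)
    ≡⟨ length-++ (List.map (x ,_) xs) ⟩
  length (List.map (x ,_) xs) ℕ.+ length (pairs xs)
    ≡⟨ cong₂ ℕ._+_ (trans (length-map (x ,_) xs) (sym (nC1≡n (length xs)))) (length-pairs xs) ⟩
  (length xs C 1) ℕ.+ (length xs C 2)
    ≡⟨ nCk+nC[k+1]≡[n+1]C[k+1] (length xs) 1 ⟩
  suc (length xs) C 2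
    ∎
  where open ≡-Reasoning

length-filter-¬ : ∀ {a p} {X : Set a} {P : Pred X p} (P? : Decidable P) (xs : List X) →
                  length (filter (λ x → ¬? (P? x)) xs) ℕ.+ length (filter P? xs) ≡ length xs
length-filter-¬ P? []       = refl
length-filter-¬ P? (x ∷ xs) with P? x
... | yes _ = trans (ℕ.+-suc _ _) (cong suc (length-filter-¬ P? xs))
... | no  _ = cong suc (length-filter-¬ P? xs)

length-cosupport : (v : Vec ℚ n) → length (cosupport v) ≡ n ℕ.∸ length (support v)
length-cosupport {n} v = begin
  c                    ≡⟨ ℕ.m+n∸m≡n s c ⟨
  (s ℕ.+ c) ℕ.∸ s      ≡⟨ cong (ℕ._∸ s) (trans (length-filter-¬ (zero? v) (allFin n))
                                               (length-tabulate {n = n} (λ i → i))) ⟩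
  n ℕ.∸ s              ∎
  where
  open ≡-Reasoning
  s c : ℕ
  s = length (support v)
  c = length (cosupport v)

length-L-entries : (v t : Vec ℚ n) → length (L-entries v t) ≡ dimL v
length-L-entries v t =
  trans (length-++ (List.map _ (pairs (support v))))
        (cong₂ ℕ._+_
          (trans (length-map _ (pairs (support v))) (length-pairs (support v)))
          (trans (length-map _ (cosupport v)) (length-cosupport v)))

L : (v : Vec ℚ n) → Vec ℚ n → Vec ℚ (dimL v)
L v t = Vec.cast (length-L-entries v t) (Vec.fromList (L-entries v t))

ι : Vec ℤ n → Vec ℚ n
ι = Vec.map fromℤ

-- L_v(A) viewed inside ℤ^m; when v ∣ᵛ w for all w ∈ A, no point of L_v(A) is
-- lost by keeping only the integral ones.
L-image : (v : Vec ℤ n) → Pred (Vec ℤ n) ℓ → Pred (Vec ℤ (dimL (ι v))) ℓ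
L-image v A u = ∃ λ t → t ∈ A × L (ι v) (ι t) ≡ ι u

data 𝓔 {ℓ} : {n : ℕ} → Pred (Vec ℤ n) ℓ → Set (Level.suc ℓ) where
  mk : ∀ {n} {A : Pred (Vec ℤ n) ℓ} → IsSubgroup A →
       (v : Vec ℤ n) → v ∈ A → v ≢ 𝟘 →
       (∀ w → w ∈ A → v ∣ᵛ w) →
       (∀ t → t ∈ A → L (ι v) (ι t) ≡ replicate _ 0ℚ) ⊎ 𝓔 (L-image v A) →
       𝓔 A

-- Functions are compared pointwise, as there is no function extensionality.
data ModLinear {N : ℕ} : ℕ → (Vec ℤ N → ℤ) → Set where
  projection : ∀ {l} (i : Fin N) → (∀ x → l x ≡ lookup x i) → ModLinear zero l
  step : ∀ {r l l₁ l₂} → ModLinear r l₁ → ModLinear r l₂ →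
         (m₁ m₂ : ℤ) → m₁ ≢ 0ℤ → m₂ ≢ 0ℤ →
         (∀ x → l x ≡ floor (fromℤ (l₁ x) ⟋ fromℤ m₁) ℤ.- ceiling (fromℤ (l₂ x) ⟋ fromℤ m₂)) →
         ModLinear (suc r) l

-- (a₁ , b₁ , a₂ , b₂ , … , aₙ , bₙ)
interleave : Vec ℤ n → Vec ℤ n → Vec ℤ (n ℕ.* 2)
interleave []       []       = []
interleave (a ∷ as) (b ∷ bs) = a ∷ b ∷ interleave as bs

{-# OPTIONS --safe #-}

-- For t ∈ A put qᵢ = tᵢ / vᵢ on the support S of v.  Some translate t + k v lies
-- in the box [a , b] iff the intervals [lᵢ - qᵢ , uᵢ - qᵢ], i ∈ S, have a common
-- integer point and aₖ ≤ tₖ ≤ bₖ off S; here lᵢ and uᵢ are the rounded bounds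
-- on the quotients.  Intervals have a common point as soon as any two of them
-- meet, so this says that lᵢ ≤ uᵢ on S and that L_v(t) lies in a box whose
-- bounds are lᵢ - uⱼ, uᵢ - lⱼ, aₖ and bₖ.  Now recurse on L_v(A), whose rank is
-- smaller: since L_v(v) = 0, the vector v is independent of any preimages of
-- independent elements of L_v(A).
--
-- The orders of the recursively obtained functions work out because
-- lᵢ - uⱼ = -(uⱼ - lᵢ) is minus a mod-linear function of order 1, the sign
-- being absorbed by the divisor, and because ⌊l / m⌋ - ⌈l / (-m)⌉ = 2⌊l / m⌋ has
-- order one more than l and determines ⌊l / m⌋ as the floor of its half.
module Submission where

open import Defs
open import Algebra.Properties.Group using (⁻¹-involutive)
open import Data.Empty using (⊥-elim)
open import Data.Fin using (Fin; zero; suc; combine)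
import Data.Fin.Properties as Fin
open import Data.Integer using (ℤ; 0ℤ; 1ℤ; +_; +[1+_]; -[1+_]; +0; _≤_; _⊔_; _⊓_)
import Data.Integer as ℤ
import Data.Integer.DivMod as ℤ
import Data.Integer.Divisibility.Signed as Signed
import Data.Integer.Properties as ℤ
open import Data.Integer.Tactic.RingSolver using (solve-∀)
open import Data.List as List using (List; []; _∷_; _++_; length)
open import Data.List.Membership.Propositional using () renaming (_∈_ to _∈ˡ_)
open import Data.List.Membership.Propositional.Properties
  using (∈-map⁺; ∈-map⁻; ∈-++⁺ˡ; ∈-++⁺ʳ; ∈-++⁻; ∈-filter⁺; ∈-filter⁻; ∈-allFin)
import Data.List.Properties as List
open import Data.List.Relation.Unary.All as AllL using (All)
import Data.List.Relation.Unary.All.Properties as AllL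
open import Data.List.Relation.Unary.Any using (here; there)
open import Data.Nat as ℕ using (ℕ; zero; suc)
import Data.Nat.Coprimality as Coprime
open import Data.Product using (_×_; _,_; proj₁; proj₂; ∃; ∃-syntax; Σ-syntax)
open import Data.Rational using (ℚ; 0ℚ; 1ℚ; mkℚ; *≤*; floor; ceiling; ↥_; ↧_)
import Data.Rational as ℚ
import Data.Rational.Properties as ℚ
open import Data.Sum as Sum using (_⊎_; inj₁; inj₂)
open import Data.Vec as Vec using (Vec; []; _∷_; lookup; replicate)
import Data.Vec.Membership.Propositional.Properties as Vec
import Data.Vec.Properties as Vec
open import Data.Vec.Relation.Unary.All as AllV using ([]; _∷_)
import Data.Vec.Relation.Unary.Any.Properties as VecAny
open import Function using (_∘_)
open import Function.Bundles using (_⇔_; mk⇔; Equivalence)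
open import Function.Construct.Composition using (_⇔-∘_)
open import Function.Related.Propositional using (module EquationalReasoning)
open import Relation.Binary.PropositionalEquality
open import Relation.Nullary using (¬_; Dec; yes; no)
open import Relation.Unary using (Pred; _∈_)

open Equivalence using (to; from)

private
  variable
    n N r : ℕ

-- Floors and ceilings of quotients of integers

-- The floor is the integer quotient `n / d`, so this is the adjunction of division with remainder:
-- `n < suc (n / d) * d` gives the converse direction.
≤floor : ∀ k p → k ≤ floor p ⇔ k ℤ.* ↧ p ≤ ↥ p
≤floor k (mkℚ n d-1 _) = mk⇔
  (λ k≤ → ℤ.≤-trans (ℤ.*-monoʳ-≤-nonNeg d k≤) (ℤ.[n/d]*d≤n n d))
  (λ kd≤n → subst (k ≤_) (ℤ.pred-suc (n ℤ./ d)) (ℤ.i<j⇒i≤pred[j]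
    (ℤ.*-cancelʳ-<-nonNeg {k} {ℤ.suc (n ℤ./ d)} d (ℤ.≤-<-trans kd≤n
     (subst (λ q → n ℤ.< ℤ.suc q ℤ.* d) (sym (ℤ.div-pos-is-/ℕ n (suc d-1)))
            (ℤ.n<s[n/ℕd]*d n (suc d-1)))))))
  where
  d : ℤ
  d = +[1+ d-1 ]

-- Unlike fromℤ z = z / 1, this form computes.
fromℤ-mkℚ : ∀ z → fromℤ z ≡ mkℚ z 0 (Coprime.sym (Coprime.1-coprimeTo _))
fromℤ-mkℚ z = ℚ.↥p/↧p≡p (mkℚ z 0 _)

fromℤ-* : ∀ x y → fromℤ (x ℤ.* y) ≡ fromℤ x ℚ.* fromℤ y
fromℤ-* x y rewrite fromℤ-mkℚ x | fromℤ-mkℚ y = refl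

fromℤ-+ : ∀ x y → fromℤ (x ℤ.+ y) ≡ fromℤ x ℚ.+ fromℤ y
fromℤ-+ x y rewrite fromℤ-mkℚ x | fromℤ-mkℚ y =
  sym (cong₂ (λ s t → fromℤ (s ℤ.+ t)) (ℤ.*-identityʳ x) (ℤ.*-identityʳ y))

fromℤ-neg : ∀ x → fromℤ (ℤ.- x) ≡ ℚ.- fromℤ x
fromℤ-neg x rewrite fromℤ-mkℚ x = trans (fromℤ-mkℚ (ℤ.- x)) (lem x)
  where
  lem : ∀ x → mkℚ (ℤ.- x) 0 (Coprime.sym (Coprime.1-coprimeTo _)) ≡
              ℚ.- mkℚ x 0 (Coprime.sym (Coprime.1-coprimeTo _))
  -- Negation on ℚ computes only once the sign of the numerator is known.
  lem +0       = refl
  lem +[1+ _ ] = refl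
  lem -[1+ _ ] = refl

fromℤ-injective : ∀ {x y} → fromℤ x ≡ fromℤ y → x ≡ y
fromℤ-injective {x} {y} eq =
  cong ↥_ (trans (sym (fromℤ-mkℚ x)) (trans eq (fromℤ-mkℚ y)))

fromℤ-≤ : ∀ x y → x ≤ y ⇔ fromℤ x ℚ.≤ fromℤ y
fromℤ-≤ x y rewrite fromℤ-mkℚ x | fromℤ-mkℚ y = mk⇔
  (λ x≤y → *≤* (ℤ.*-monoʳ-≤-nonNeg 1ℤ x≤y))
  (λ { (*≤* x≤y) → ℤ.*-cancelʳ-≤-pos x y 1ℤ x≤y })

≤floor-fromℤ : ∀ k p → k ≤ floor p ⇔ fromℤ k ℚ.≤ p
≤floor-fromℤ k p = aux p ⇔-∘ ≤floor k p
  where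
  aux : ∀ p → k ℤ.* ↧ p ≤ ↥ p ⇔ fromℤ k ℚ.≤ p
  aux p rewrite fromℤ-mkℚ k = mk⇔
    (λ h → *≤* (subst (k ℤ.* ↧ p ≤_) (sym (ℤ.*-identityʳ (↥ p))) h))
    (λ { (*≤* h) → subst (k ℤ.* ↧ p ≤_) (ℤ.*-identityʳ (↥ p)) h })

fromℤ≢0 : ∀ {m} → m ≢ 0ℤ → fromℤ m ≢ 0ℚ
fromℤ≢0 m≢0 = m≢0 ∘ fromℤ-injective

⟋-* : ∀ p q → q ≢ 0ℚ → (p ⟋ q) ℚ.* q ≡ p
⟋-* p q q≢0 with q ℚ.≟ 0ℚ
... | yes q≡0 = ⊥-elim (q≢0 q≡0)
... | no  q≢0 = begin
  (p ℚ.* ℚ.1/ q) ℚ.* q  ≡⟨ ℚ.*-assoc p (ℚ.1/ q) q ⟩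
  p ℚ.* (ℚ.1/ q ℚ.* q)  ≡⟨ cong (p ℚ.*_) (ℚ.*-inverseˡ q) ⟩
  p ℚ.* 1ℚ              ≡⟨ ℚ.*-identityʳ p ⟩
  p                     ∎
  where
  open ≡-Reasoning
  instance _ = ℚ.≢-nonZero q≢0

*-⟋ : ∀ p q → q ≢ 0ℚ → (p ℚ.* q) ⟋ q ≡ p
*-⟋ p q q≢0 with q ℚ.≟ 0ℚ
... | yes q≡0 = ⊥-elim (q≢0 q≡0)
... | no  q≢0 = begin
  (p ℚ.* q) ℚ.* ℚ.1/ q  ≡⟨ ℚ.*-assoc p q (ℚ.1/ q) ⟩
  p ℚ.* (q ℚ.* ℚ.1/ q)  ≡⟨ cong (p ℚ.*_) (ℚ.*-inverseʳ q) ⟩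
  p ℚ.* 1ℚ              ≡⟨ ℚ.*-identityʳ p ⟩
  p                     ∎
  where
  open ≡-Reasoning
  instance _ = ℚ.≢-nonZero q≢0

-- Writing `p` as a multiple of `- q` lets `*-⟋` cancel, so the case split inside the total division
-- is never unfolded.
⟋-neg : ∀ p q → q ≢ 0ℚ → p ⟋ (ℚ.- q) ≡ ℚ.- (p ⟋ q)
⟋-neg p q q≢0 = begin
  p ⟋ (ℚ.- q)                               ≡⟨ cong (_⟋ (ℚ.- q)) p≡ ⟨
  (ℚ.- (p ⟋ q) ℚ.* ℚ.- q) ⟋ (ℚ.- q)         ≡⟨ *-⟋ (ℚ.- (p ⟋ q)) (ℚ.- q) -q≢0 ⟩
  ℚ.- (p ⟋ q)                               ∎
  where
  open ≡-Reasoning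
  -q≢0 : ℚ.- q ≢ 0ℚ
  -q≢0 eq = q≢0 (ℚ.neg-injective eq)
  p≡ : ℚ.- (p ⟋ q) ℚ.* ℚ.- q ≡ p
  p≡ = begin
    ℚ.- (p ⟋ q) ℚ.* ℚ.- q      ≡⟨ ℚ.neg-distribˡ-* (p ⟋ q) (ℚ.- q) ⟨
    ℚ.- ((p ⟋ q) ℚ.* ℚ.- q)    ≡⟨ cong ℚ.-_ (ℚ.neg-distribʳ-* (p ⟋ q) q) ⟨
    ℚ.- (ℚ.- ((p ⟋ q) ℚ.* q))  ≡⟨ ⁻¹-involutive ℚ.+-0-group _ ⟩
    (p ⟋ q) ℚ.* q              ≡⟨ ⟋-* p q q≢0 ⟩
    p                          ∎

-‿≢0 : ∀ {m} → m ≢ 0ℤ → ℤ.- m ≢ 0ℤ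
-‿≢0 m≢0 eq = m≢0 (ℤ.neg-injective eq)

ceiling≡-floor- : ∀ p → ceiling p ≡ ℤ.- floor (ℚ.- p)
ceiling≡-floor- (mkℚ _ _ _) = refl

+[1+]≢0 : ∀ {n} → +[1+ n ] ≢ 0ℤ
+[1+]≢0 ()

-- Opaque because unfolding quotients of normalised fractions blows up type checking.
opaque
  ⌊_÷_⌋ ⌈_÷_⌉ : ℤ → ℤ → ℤ
  ⌊ a ÷ m ⌋ = floor (fromℤ a ⟋ fromℤ m)
  ⌈ a ÷ m ⌉ = ceiling (fromℤ a ⟋ fromℤ m)

  ⌊÷⌋-def : ∀ a m → ⌊ a ÷ m ⌋ ≡ floor (fromℤ a ⟋ fromℤ m)
  ⌊÷⌋-def _ _ = refl

  ⌈÷⌉-def : ∀ a m → ⌈ a ÷ m ⌉ ≡ ceiling (fromℤ a ⟋ fromℤ m)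
  ⌈÷⌉-def _ _ = refl

  ⌈÷⌉≡-⌊÷-⌋ : ∀ a {m} → m ≢ 0ℤ → ⌈ a ÷ m ⌉ ≡ ℤ.- ⌊ a ÷ ℤ.- m ⌋
  ⌈÷⌉≡-⌊÷-⌋ a {m} m≢0 = trans (ceiling≡-floor- (fromℤ a ⟋ fromℤ m)) (cong (λ p → ℤ.- floor p) (begin
    ℚ.- (fromℤ a ⟋ fromℤ m)    ≡⟨ ⟋-neg (fromℤ a) (fromℤ m) (fromℤ≢0 m≢0) ⟨
    fromℤ a ⟋ (ℚ.- fromℤ m)    ≡⟨ cong (fromℤ a ⟋_) (fromℤ-neg m) ⟨
    fromℤ a ⟋ fromℤ (ℤ.- m)    ∎))
    where open ≡-Reasoning

  -- Clears the positive denominator in ℚ. The companion rules for ceilings and for negative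
  -- divisors follow from this one by changes of sign.
  ≤⌊÷pos⌋ : ∀ n k a → k ≤ ⌊ a ÷ +[1+ n ] ⌋ ⇔ k ℤ.* +[1+ n ] ≤ a
  ≤⌊÷pos⌋ n k a = mk⇔
    (λ h → from (fromℤ-≤ (k ℤ.* m) a) (subst₂ ℚ._≤_ (sym (fromℤ-* k m)) p*m≡a
             (ℚ.*-monoʳ-≤-nonNeg (fromℤ m) {{ℚ.pos⇒nonNeg (fromℤ m)}} (to (≤floor-fromℤ k p) h))))
    (λ h → from (≤floor-fromℤ k p) (ℚ.*-cancelʳ-≤-pos {fromℤ k} {p} (fromℤ m)
             (subst₂ ℚ._≤_ (fromℤ-* k m) (sym p*m≡a) (to (fromℤ-≤ (k ℤ.* m) a) h))))
    where
    m : ℤ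
    m = +[1+ n ]
    instance
      m-pos : ℚ.Positive (fromℤ m)
      m-pos = subst ℚ.Positive (sym (fromℤ-mkℚ m)) _
    p : ℚ
    p = fromℤ a ⟋ fromℤ m
    p*m≡a : p ℚ.* fromℤ m ≡ fromℤ a
    p*m≡a = ⟋-* (fromℤ a) (fromℤ m) (fromℤ≢0 {m} (+[1+]≢0 {n}))

  -- Both sides are floors of one rational `p`, as `a = p * (- m)` shows. Moving the sign into the
  -- divisor is what makes `floors-neg` possible.
  ⌊-÷⌋ : ∀ a {m} → m ≢ 0ℤ → ⌊ ℤ.- a ÷ m ⌋ ≡ ⌊ a ÷ ℤ.- m ⌋
  ⌊-÷⌋ a {m} m≢0 = sym (cong floor (begin
    fromℤ a ⟋ fromℤ (ℤ.- m)                   ≡⟨ cong (λ b → b ⟋ fromℤ (ℤ.- m)) a≡ ⟩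
    (p ℚ.* fromℤ (ℤ.- m)) ⟋ fromℤ (ℤ.- m)     ≡⟨ *-⟋ p (fromℤ (ℤ.- m)) (fromℤ≢0 (-‿≢0 m≢0)) ⟩
    p                                         ∎))
    where
    open ≡-Reasoning
    p : ℚ
    p = fromℤ (ℤ.- a) ⟋ fromℤ m
    a≡ : fromℤ a ≡ p ℚ.* fromℤ (ℤ.- m)
    a≡ = begin
      fromℤ a               ≡⟨ cong fromℤ (ℤ.neg-involutive a) ⟨
      fromℤ (ℤ.- (ℤ.- a))   ≡⟨ fromℤ-neg (ℤ.- a) ⟩
      ℚ.- fromℤ (ℤ.- a)     ≡⟨ cong ℚ.-_ (⟋-* (fromℤ (ℤ.- a)) (fromℤ m) (fromℤ≢0 m≢0)) ⟨
      ℚ.- (p ℚ.* fromℤ m)   ≡⟨ ℚ.neg-distribʳ-* p (fromℤ m) ⟩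
      p ℚ.* ℚ.- fromℤ m     ≡⟨ cong (p ℚ.*_) (fromℤ-neg m) ⟨
      p ℚ.* fromℤ (ℤ.- m)   ∎

  ⌈÷⌉≡-⌊-÷⌋ : ∀ a {m} → m ≢ 0ℤ → ⌈ a ÷ m ⌉ ≡ ℤ.- ⌊ ℤ.- a ÷ m ⌋
  ⌈÷⌉≡-⌊-÷⌋ a m≢0 = trans (⌈÷⌉≡-⌊÷-⌋ a m≢0) (cong ℤ.-_ (sym (⌊-÷⌋ a m≢0)))

neg-≤-swapˡ : ∀ {x y} → ℤ.- x ≤ y ⇔ ℤ.- y ≤ x
neg-≤-swapˡ {x} {y} = mk⇔
  (λ h → subst (ℤ.- y ≤_) (ℤ.neg-involutive x) (ℤ.neg-mono-≤ h))
  (λ h → subst (ℤ.- x ≤_) (ℤ.neg-involutive y) (ℤ.neg-mono-≤ h))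

neg-≤-swapʳ : ∀ {x y} → x ≤ ℤ.- y ⇔ y ≤ ℤ.- x
neg-≤-swapʳ {x} {y} = mk⇔
  (λ h → subst (_≤ ℤ.- x) (ℤ.neg-involutive y) (ℤ.neg-mono-≤ h))
  (λ h → subst (_≤ ℤ.- y) (ℤ.neg-involutive x) (ℤ.neg-mono-≤ h))

⌈÷pos⌉≤ : ∀ n k a → ⌈ a ÷ +[1+ n ] ⌉ ≤ k ⇔ a ≤ k ℤ.* +[1+ n ]
⌈÷pos⌉≤ n k a = begin
  ⌈ a ÷ m ⌉ ≤ k             ≡⟨ cong (_≤ k) (⌈÷⌉≡-⌊-÷⌋ a (+[1+]≢0 {n})) ⟩
  ℤ.- ⌊ ℤ.- a ÷ m ⌋ ≤ k     ∼⟨ neg-≤-swapˡ ⟩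
  ℤ.- k ≤ ⌊ ℤ.- a ÷ m ⌋     ∼⟨ ≤⌊÷pos⌋ n (ℤ.- k) (ℤ.- a) ⟩
  ℤ.- k ℤ.* m ≤ ℤ.- a       ∼⟨ neg-≤-swapʳ ⟩
  a ≤ ℤ.- (ℤ.- k ℤ.* m)     ≡⟨ cong (a ≤_) (eq k m) ⟩
  a ≤ k ℤ.* m               ∎
  where
  open EquationalReasoning
  m : ℤ
  m = +[1+ n ]
  eq : ∀ k m → ℤ.- (ℤ.- k ℤ.* m) ≡ k ℤ.* m
  eq = solve-∀

≤⌊÷neg⌋ : ∀ n k a → k ≤ ⌊ a ÷ -[1+ n ] ⌋ ⇔ a ≤ k ℤ.* -[1+ n ]
≤⌊÷neg⌋ n k a = begin
  k ≤ ⌊ a ÷ ℤ.- m ⌋      ≡⟨ cong (k ≤_) (⌊-÷⌋ a (+[1+]≢0 {n})) ⟨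
  k ≤ ⌊ ℤ.- a ÷ m ⌋      ∼⟨ ≤⌊÷pos⌋ n k (ℤ.- a) ⟩
  k ℤ.* m ≤ ℤ.- a        ∼⟨ neg-≤-swapʳ ⟩
  a ≤ ℤ.- (k ℤ.* m)      ≡⟨ cong (a ≤_) (ℤ.neg-distribʳ-* k m) ⟩
  a ≤ k ℤ.* ℤ.- m        ∎
  where
  open EquationalReasoning
  m : ℤ
  m = +[1+ n ]

⌈÷neg⌉≤ : ∀ n k a → ⌈ a ÷ -[1+ n ] ⌉ ≤ k ⇔ k ℤ.* -[1+ n ] ≤ a
⌈÷neg⌉≤ n k a = begin
  ⌈ a ÷ ℤ.- m ⌉ ≤ k        ≡⟨ cong (_≤ k) (⌈÷⌉≡-⌊÷-⌋ a (-‿≢0 (+[1+]≢0 {n}))) ⟩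
  ℤ.- ⌊ a ÷ m ⌋ ≤ k        ∼⟨ neg-≤-swapˡ ⟩
  ℤ.- k ≤ ⌊ a ÷ m ⌋        ∼⟨ ≤⌊÷pos⌋ n (ℤ.- k) a ⟩
  ℤ.- k ℤ.* m ≤ a          ≡⟨ cong (_≤ a) (eq k m) ⟩
  k ℤ.* ℤ.- m ≤ a          ∎
  where
  open EquationalReasoning
  m : ℤ
  m = +[1+ n ]
  eq : ∀ k m → ℤ.- k ℤ.* m ≡ k ℤ.* ℤ.- m
  eq = solve-∀

⌊*÷⌋ : ∀ k n → ⌊ k ℤ.* +[1+ n ] ÷ +[1+ n ] ⌋ ≡ k
⌊*÷⌋ k n = ℤ.≤-antisym
  (ℤ.*-cancelʳ-≤-pos _ k +[1+ n ] (to (≤⌊÷pos⌋ n _ (k ℤ.* +[1+ n ])) ℤ.≤-refl))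
  (from (≤⌊÷pos⌋ n k (k ℤ.* +[1+ n ])) ℤ.≤-refl)

-- Used, like its mirror image below, to turn a bound on a difference of quotients into the meeting
-- of two translated intervals.
≤-transposeʳ : ∀ a b c d → a ℤ.- b ≤ c ℤ.- d → a ℤ.- c ≤ b ℤ.- d
≤-transposeʳ a b c d h = subst₂ _≤_ (eq₁ a b c) (eq₂ b c d) (ℤ.+-monoˡ-≤ (b ℤ.- c) h)
  where
  eq₁ : ∀ a b c → (a ℤ.- b) ℤ.+ (b ℤ.- c) ≡ a ℤ.- c
  eq₁ = solve-∀
  eq₂ : ∀ b c d → (c ℤ.- d) ℤ.+ (b ℤ.- c) ≡ b ℤ.- d
  eq₂ = solve-∀

≤-transposeˡ : ∀ a b c d → a ℤ.- b ≤ c ℤ.- d → d ℤ.- b ≤ c ℤ.- a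
≤-transposeˡ a b c d h = subst₂ _≤_ (eq₁ a b d) (eq₂ a c d) (ℤ.+-monoˡ-≤ (d ℤ.- a) h)
  where
  eq₁ : ∀ a b d → (a ℤ.- b) ℤ.+ (d ℤ.- a) ≡ d ℤ.- b
  eq₁ = solve-∀
  eq₂ : ∀ a c d → (c ℤ.- d) ℤ.+ (d ℤ.- a) ≡ c ℤ.- a
  eq₂ = solve-∀

-- Mod-linear functions

ModLinear-resp : ∀ {l l′ : Vec ℤ N → ℤ} → l ≗ l′ → ModLinear r l → ModLinear r l′
ModLinear-resp l≗l′ (projection i l≗) = projection i λ x → trans (sym (l≗l′ x)) (l≗ x)
ModLinear-resp l≗l′ (step p q m₁ m₂ m₁≢0 m₂≢0 l≗) =
  step p q m₁ m₂ m₁≢0 m₂≢0 λ x → trans (sym (l≗l′ x)) (l≗ x)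

floor-ceiling-def : ∀ a m b k → ⌊ a ÷ m ⌋ ℤ.- ⌈ b ÷ k ⌉ ≡
                    floor (fromℤ a ⟋ fromℤ m) ℤ.- ceiling (fromℤ b ⟋ fromℤ k)
floor-ceiling-def a m b k = cong₂ ℤ._-_ (⌊÷⌋-def a m) (⌈÷⌉-def b k)

floor-ceiling : ∀ {l₁ l₂ : Vec ℤ N → ℤ} {m₁ m₂} → m₁ ≢ 0ℤ → m₂ ≢ 0ℤ →
                ModLinear r l₁ → ModLinear r l₂ →
                ModLinear (suc r) (λ x → ⌊ l₁ x ÷ m₁ ⌋ ℤ.- ⌈ l₂ x ÷ m₂ ⌉)
floor-ceiling m₁≢0 m₂≢0 p q = step p q _ _ m₁≢0 m₂≢0 λ x → floor-ceiling-def _ _ _ _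

-- The orders in ModLinear are exact, and a projection need not be of order 1.
-- To substitute g into a function of positive order, however, it suffices that
-- all ⌊ g / m ⌋ are floors of fractions of functions of the right order.
FloorsOfOrder : ℕ → (Vec ℤ N → ℤ) → Set
FloorsOfOrder r g = ∀ {m} → m ≢ 0ℤ →
  ∃[ h ] ∃[ m′ ] ModLinear r h × m′ ≢ 0ℤ × (∀ x → ⌊ g x ÷ m ⌋ ≡ ⌊ h x ÷ m′ ⌋)

floors : ∀ {g : Vec ℤ N → ℤ} → ModLinear r g → FloorsOfOrder r g
floors p m≢0 = _ , _ , p , m≢0 , λ _ → refl

floors-neg : ∀ {g : Vec ℤ N → ℤ} → FloorsOfOrder r g → FloorsOfOrder r (ℤ.-_ ∘ g)
floors-neg {g = g} p m≢0 with h , m′ , h-lin , m′≢0 , g≗h ← p (-‿≢0 m≢0) =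
  h , m′ , h-lin , m′≢0 , λ x → trans (⌊-÷⌋ (g x) m≢0) (g≗h x)

floors-resp : ∀ {g g′ : Vec ℤ N → ℤ} → g ≗ g′ → FloorsOfOrder r g → FloorsOfOrder r g′
floors-resp g≗g′ p {m} m≢0 with h , m′ , h-lin , m′≢0 , g≗h ← p m≢0 =
  h , m′ , h-lin , m′≢0 , λ x → trans (cong (⌊_÷ m ⌋) (sym (g≗g′ x))) (g≗h x)

-- With divisor `- m` the ceiling is minus the floor of `a / m`, so the subtraction in `step`
-- becomes an addition.
double : ∀ (a : ℤ) {m} → m ≢ 0ℤ → ⌊ a ÷ m ⌋ ℤ.- ⌈ a ÷ ℤ.- m ⌉ ≡ ⌊ a ÷ m ⌋ ℤ.* + 2
double a {m} m≢0 = begin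
  ⌊ a ÷ m ⌋ ℤ.- ⌈ a ÷ ℤ.- m ⌉                   ≡⟨ cong (λ k → ⌊ a ÷ m ⌋ ℤ.- k) (⌈÷⌉≡-⌊÷-⌋ a (-‿≢0 m≢0)) ⟩
  ⌊ a ÷ m ⌋ ℤ.- (ℤ.- ⌊ a ÷ ℤ.- (ℤ.- m) ⌋)       ≡⟨ cong (λ k → ⌊ a ÷ m ⌋ ℤ.- (ℤ.- ⌊ a ÷ k ⌋)) (ℤ.neg-involutive m) ⟩
  ⌊ a ÷ m ⌋ ℤ.- (ℤ.- ⌊ a ÷ m ⌋)                 ≡⟨ eq ⌊ a ÷ m ⌋ ⟩
  ⌊ a ÷ m ⌋ ℤ.* + 2                             ∎
  where
  open ≡-Reasoning
  eq : ∀ f → f ℤ.- (ℤ.- f) ≡ f ℤ.* + 2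
  eq = solve-∀

floors-suc : ∀ {g : Vec ℤ N → ℤ} → ModLinear r g → FloorsOfOrder (suc r) g
floors-suc {g = g} p {m} m≢0 =
  -- The witness is twice the floor, divided by 2 again. The final argument 1 of `⌊*÷⌋` encodes the
  -- divisor 2 as `+[1+ 1 ]`.
  _ , + 2 , floor-ceiling m≢0 (-‿≢0 m≢0) p p , (λ ()) ,
  λ x → sym (trans (cong (⌊_÷ + 2 ⌋) (double (g x) m≢0)) (⌊*÷⌋ ⌊ g x ÷ m ⌋ 1))

-- `FloorsOfOrder` speaks of floors alone, so the ceiling is first rewritten as minus a floor with
-- divisor `- m₂`, replaced there, and turned back into a ceiling with divisor `- k₂`.
floor-ceiling′ : ∀ {g₁ g₂ : Vec ℤ N → ℤ} {m₁ m₂} → m₁ ≢ 0ℤ → m₂ ≢ 0ℤ →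
                 FloorsOfOrder r g₁ → FloorsOfOrder r g₂ →
                 ModLinear (suc r) (λ x → ⌊ g₁ x ÷ m₁ ⌋ ℤ.- ⌈ g₂ x ÷ m₂ ⌉)
floor-ceiling′ {g₁ = g₁} {g₂} {m₁} {m₂} m₁≢0 m₂≢0 p q
  with h₁ , k₁ , h₁-lin , k₁≢0 , g₁≗h₁ ← p m₁≢0
     | h₂ , k₂ , h₂-lin , k₂≢0 , g₂≗h₂ ← q (-‿≢0 m₂≢0) =
  ModLinear-resp (λ x → cong₂ ℤ._-_ (sym (g₁≗h₁ x)) (sym (ceil x)))
    (floor-ceiling k₁≢0 (-‿≢0 k₂≢0) h₁-lin h₂-lin)
  where
  open ≡-Reasoning
  ceil : ∀ x → ⌈ g₂ x ÷ m₂ ⌉ ≡ ⌈ h₂ x ÷ ℤ.- k₂ ⌉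
  ceil x = begin
    ⌈ g₂ x ÷ m₂ ⌉                    ≡⟨ ⌈÷⌉≡-⌊÷-⌋ (g₂ x) m₂≢0 ⟩
    ℤ.- ⌊ g₂ x ÷ ℤ.- m₂ ⌋            ≡⟨ cong ℤ.-_ (g₂≗h₂ x) ⟩
    ℤ.- ⌊ h₂ x ÷ k₂ ⌋                ≡⟨ cong (λ k → ℤ.- ⌊ h₂ x ÷ k ⌋) (ℤ.neg-involutive k₂) ⟨
    ℤ.- ⌊ h₂ x ÷ ℤ.- (ℤ.- k₂) ⌋      ≡⟨ ⌈÷⌉≡-⌊÷-⌋ (h₂ x) (-‿≢0 k₂≢0) ⟨
    ⌈ h₂ x ÷ ℤ.- k₂ ⌉                ∎

-- Both inner functions are exchanged for functions of the next order with the same floors. The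
-- argument starts at order 1, where there are floors to rewrite.
ModLinear-suc : ∀ {l : Vec ℤ N → ℤ} → ModLinear (suc r) l → ModLinear (suc (suc r)) l
ModLinear-suc (step {l₁ = l₁} {l₂} p q m₁ m₂ m₁≢0 m₂≢0 l≗) =
  ModLinear-resp (λ x → trans (floor-ceiling-def (l₁ x) m₁ (l₂ x) m₂) (sym (l≗ x)))
    (floor-ceiling′ m₁≢0 m₂≢0 (floors-suc p) (floors-suc q))

ModLinear-1≤ : ∀ {l : Vec ℤ N → ℤ} → ModLinear 1 l → ∀ r → ModLinear (suc r) l
ModLinear-1≤ p zero    = p
ModLinear-1≤ p (suc r) = ModLinear-suc (ModLinear-1≤ p r)

module _ {M N} {σ : Vec ℤ N → Vec ℤ M} (σ-floors : ∀ i → FloorsOfOrder 1 (λ x → lookup (σ x) i)) where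

  -- Substitution of `σ` raises the order by one, by mutual induction. A projection composed with
  -- `σ` is a component of `σ`, about which only the floors are known; a function of positive order
  -- is rebuilt from the floors of its two constituents.
  floors-∘ : ∀ {l} → ModLinear r l → FloorsOfOrder (suc r) (l ∘ σ)
  ModLinear-∘ : ∀ {l} → ModLinear (suc r) l → ModLinear (suc (suc r)) (l ∘ σ)

  floors-∘ (projection i l≗)      = floors-resp (λ x → sym (l≗ (σ x))) (σ-floors i)
  floors-∘ p@(step _ _ _ _ _ _ _) = floors (ModLinear-∘ p)

  ModLinear-∘ (step {l₁ = l₁} {l₂} p q m₁ m₂ m₁≢0 m₂≢0 l≗) =
    ModLinear-resp
      (λ x → trans (floor-ceiling-def (l₁ (σ x)) m₁ (l₂ (σ x)) m₂) (sym (l≗ (σ x))))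
      (floor-ceiling′ m₁≢0 m₂≢0 (floors-∘ p) (floors-∘ q))

0≤*2 : ∀ k → 0ℤ ≤ k ℤ.* + 2 ⇔ 0ℤ ≤ k
0≤*2 k = mk⇔ (ℤ.*-cancelʳ-≤-pos 0ℤ k (+ 2)) (ℤ.*-monoʳ-≤-nonNeg (+ 2))

module _ (i : Fin N) where
  private
    -- A coordinate has order 0, but its sign can be read off from this function of order 1: `m = 1`
    -- tests for `0 ≤ xᵢ` and `m = -1` for `xᵢ ≤ 0`.
    two-floors : ∀ m → m ≢ 0ℤ → ModLinear 1 (λ x → ⌊ lookup x i ÷ m ⌋ ℤ.* + 2)
    two-floors m m≢0 = ModLinear-resp (λ x → double (lookup x i) m≢0)
      (floor-ceiling m≢0 (-‿≢0 m≢0) (projection i λ _ → refl) (projection i λ _ → refl))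

  nonneg-test : ∃[ l ] ModLinear 1 l × (∀ x → 0ℤ ≤ l x ⇔ 0ℤ ≤ lookup x i)
  nonneg-test = _ , two-floors 1ℤ (λ ()) , λ x → ≤⌊÷pos⌋ 0 0ℤ (lookup x i) ⇔-∘ 0≤*2 _

  nonpos-test : ∃[ l ] ModLinear 1 l × (∀ x → 0ℤ ≤ l x ⇔ lookup x i ≤ 0ℤ)
  nonpos-test = _ , two-floors (ℤ.- 1ℤ) (λ ()) , λ x → ≤⌊÷neg⌋ 0 0ℤ (lookup x i) ⇔-∘ 0≤*2 _

-- Helly's theorem for integer intervals

module _ {X : Set} (f g : X → ℤ) where
  -- By induction, clamping a common point `k` of the tail into the interval of `x`. If `k` moves,
  -- it moves to an end of that interval which the pairwise hypothesis keeps on the right side of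
  -- the ends of all others. Taking `x = y` in the hypothesis makes each interval nonempty.
  common-point : ∀ xs → (∀ {x y} → x ∈ˡ xs → y ∈ˡ xs → f x ≤ g y) →
                 ∃[ k ] (∀ {x} → x ∈ˡ xs → f x ≤ k × k ≤ g x)
  common-point []       _   = 0ℤ , λ ()
  common-point (x ∷ xs) f≤g with k , k-ok ← common-point xs (λ p q → f≤g (there p) (there q)) =
    (f x ⊔ k) ⊓ g x , λ
      { (here refl) → ℤ.⊓-glb (ℤ.i≤i⊔j (f x) k) (f≤g (here refl) (here refl)) , ℤ.i⊓j≤j _ (g x)
      ; (there p) →
          ℤ.⊓-glb (ℤ.≤-trans (proj₁ (k-ok p)) (ℤ.i≤j⊔i (f x) k)) (f≤g (there p) (here refl)) ,
          ℤ.≤-trans (ℤ.i⊓j≤i _ (g x)) (ℤ.⊔-lub (f≤g (here refl) (there p)) (proj₂ (k-ok p)))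
      }

-- The map L_v over ℤ

lookup-ext : ∀ {X : Set} {xs ys : Vec X n} → (∀ i → lookup xs i ≡ lookup ys i) → xs ≡ ys
lookup-ext {xs = xs} {ys} eq =
  trans (sym (Vec.tabulate∘lookup xs)) (trans (Vec.tabulate-cong eq) (Vec.tabulate∘lookup ys))

lookup-⊕ : ∀ (x y : Vec ℤ n) i → lookup (x ⊕ y) i ≡ lookup x i ℤ.+ lookup y i
lookup-⊕ x y i = Vec.lookup-zipWith ℤ._+_ i x y

lookup-· : ∀ k (x : Vec ℤ n) i → lookup (k · x) i ≡ k ℤ.* lookup x i
lookup-· k x i = Vec.lookup-map i (k ℤ.*_) x

lookup-𝟘 : ∀ (i : Fin n) → lookup 𝟘 i ≡ 0ℤ
lookup-𝟘 i = Vec.lookup-replicate i 0ℤ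

lookup-ι : ∀ (x : Vec ℤ n) i → lookup (ι x) i ≡ fromℤ (lookup x i)
lookup-ι x i = Vec.lookup-map i fromℤ x

ι-injective : ∀ {x y : Vec ℤ n} → ι x ≡ ι y → x ≡ y
ι-injective {x = x} {y} eq = lookup-ext λ i → fromℤ-injective
  (trans (sym (lookup-ι x i)) (trans (cong (λ z → lookup z i) eq) (lookup-ι y i)))

module _ {X : Set} where

  -- Stated for `ys` with an equation because `L-entries` is a `map` over the indices only
  -- propositionally.
  cast-map : ∀ {Y : Set} {m} (f : X → Y) xs {ys} → ys ≡ List.map f xs →
             .(e : length ys ≡ m) (e′ : length xs ≡ m) →
             Vec.cast e (Vec.fromList ys) ≡ Vec.map f (Vec.cast e′ (Vec.fromList xs))
  cast-map f xs refl e refl = trans (Vec.fromList-map f xs)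
    (cong (Vec.map f) (sym (Vec.cast-is-id refl (Vec.fromList xs))))

  ∈⇒lookup-cast : ∀ {m x} {xs : List X} (e : length xs ≡ m) → x ∈ˡ xs →
                  ∃[ i ] lookup (Vec.cast e (Vec.fromList xs)) i ≡ x
  ∈⇒lookup-cast {xs = xs} refl x∈xs rewrite Vec.cast-is-id refl (Vec.fromList xs) =
    _ , sym (VecAny.lookup-index (Vec.∈-fromList⁺ x∈xs))

  lookup-cast-∈ : ∀ {m} (xs : List X) (e : length xs ≡ m) i →
                  lookup (Vec.cast e (Vec.fromList xs)) i ∈ˡ xs
  lookup-cast-∈ xs refl i rewrite Vec.cast-is-id refl (Vec.fromList xs) =
    Vec.∈-fromList⁻ (Vec.∈-lookup i (Vec.fromList xs))

  ∈-pairs⁻ : ∀ {x y} (xs : List X) → (x , y) ∈ˡ pairs xs → x ∈ˡ xs × y ∈ˡ xs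
  ∈-pairs⁻ (z ∷ zs) p with ∈-++⁻ (List.map (z ,_) zs) p
  ... | inj₁ q with y , y∈zs , refl ← ∈-map⁻ (z ,_) q = here refl , there y∈zs
  ... | inj₂ q with x∈zs , y∈zs ← ∈-pairs⁻ zs q = there x∈zs , there y∈zs

  ∈-pairs⁺ : ∀ {x y} {xs : List X} → x ∈ˡ xs → y ∈ˡ xs →
             x ≡ y ⊎ (x , y) ∈ˡ pairs xs ⊎ (y , x) ∈ˡ pairs xs
  ∈-pairs⁺ (here refl) (here refl) = inj₁ refl
  ∈-pairs⁺ (here refl) (there q)   = inj₂ (inj₁ (∈-++⁺ˡ (∈-map⁺ _ q)))
  ∈-pairs⁺ (there p)   (here refl) = inj₂ (inj₂ (∈-++⁺ˡ (∈-map⁺ _ p)))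
  ∈-pairs⁺ (there p)   (there q) with ∈-pairs⁺ p q
  ... | inj₁ x≡y      = inj₁ x≡y
  ... | inj₂ (inj₁ r) = inj₂ (inj₁ (∈-++⁺ʳ _ r))
  ... | inj₂ (inj₂ r) = inj₂ (inj₂ (∈-++⁺ʳ _ r))

-- Labels for the coordinates of `L_v`, so that values and bounds are given by cases on a label
-- instead of a position in a concatenated list.
Index : ℕ → Set
Index n = (Fin n × Fin n) ⊎ Fin n

indices : Vec ℚ n → List (Index n)
indices v = List.map inj₁ (pairs (support v)) List.++ List.map inj₂ (cosupport v)

∈-indices⁻ : ∀ (v : Vec ℚ n) {c} → c ∈ˡ indices v →
             (∃[ p ] p ∈ˡ pairs (support v) × c ≡ inj₁ p) ⊎ (∃[ k ] k ∈ˡ cosupport v × c ≡ inj₂ k)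
∈-indices⁻ v c∈ = Sum.map (∈-map⁻ inj₁) (∈-map⁻ inj₂) (∈-++⁻ (List.map inj₁ (pairs (support v))) c∈)

∈-indices⁺₁ : ∀ (v : Vec ℚ n) {p} → p ∈ˡ pairs (support v) → inj₁ p ∈ˡ indices v
∈-indices⁺₁ v p∈ = ∈-++⁺ˡ (∈-map⁺ inj₁ p∈)

∈-indices⁺₂ : ∀ (v : Vec ℚ n) {k} → k ∈ˡ cosupport v → inj₂ k ∈ˡ indices v
∈-indices⁺₂ v k∈ = ∈-++⁺ʳ (List.map inj₁ (pairs (support v))) (∈-map⁺ inj₂ k∈)

L-entry : Vec ℚ n → Vec ℚ n → Index n → ℚ
L-entry v t (inj₁ (i , j)) = (lookup t i ⟋ lookup v i) ℚ.- (lookup t j ⟋ lookup v j)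
L-entry v t (inj₂ k)       = lookup t k

L-entries≡ : ∀ (v t : Vec ℚ n) → L-entries v t ≡ List.map (L-entry v t) (indices v)
L-entries≡ v t = sym (trans (List.map-++ (L-entry v t) (List.map inj₁ (pairs (support v))) _)
  (cong₂ List._++_ (sym (List.map-∘ (pairs (support v)))) (sym (List.map-∘ (cosupport v)))))

length-indices : ∀ (v : Vec ℚ n) → length (indices v) ≡ dimL v
length-indices v = begin
  length (indices v)                           ≡⟨ List.length-map (L-entry v v) (indices v) ⟨
  length (List.map (L-entry v v) (indices v))  ≡⟨ cong length (L-entries≡ v v) ⟨
  length (L-entries v v)                       ≡⟨ length-L-entries v v ⟩
  dimL v                                       ∎
  where open ≡-Reasoning

module Reduction {n} (v : Vec ℤ n) where

  m : ℕ
  m = dimL (ι v)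

  opaque
    -- Known outside this block through three facts: it presents `L_v` as a `map`, it reaches every
    -- label in `indices`, and it contains no others.
    index : Vec (Index n) m
    index = Vec.cast (length-indices (ι v)) (Vec.fromList (indices (ι v)))

    L≡map : ∀ t → L (ι v) t ≡ Vec.map (L-entry (ι v) t) index
    L≡map t = cast-map (L-entry (ι v) t) (indices (ι v)) (L-entries≡ (ι v) t) _ (length-indices (ι v))

    index-surjective : ∀ {c} → c ∈ˡ indices (ι v) → ∃[ i ] lookup index i ≡ c
    index-surjective = ∈⇒lookup-cast (length-indices (ι v))

    index-∈ : ∀ i → lookup index i ∈ˡ indices (ι v)
    index-∈ = lookup-cast-∈ (indices (ι v)) (length-indices (ι v))

  ∈-support : ∀ i → i ∈ˡ support (ι v) ⇔ lookup v i ≢ 0ℤ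
  ∈-support i = mk⇔
    (λ p eq → proj₂ (∈-filter⁻ _ {xs = List.allFin n} p) (trans (lookup-ι v i) (cong fromℤ eq)))
    (λ vᵢ≢0 → ∈-filter⁺ _ (∈-allFin i) (λ eq → vᵢ≢0 (fromℤ-injective (trans (sym (lookup-ι v i)) eq))))

  ∈-cosupport : ∀ i → i ∈ˡ cosupport (ι v) ⇔ lookup v i ≡ 0ℤ
  ∈-cosupport i = mk⇔
    (λ p → fromℤ-injective (trans (sym (lookup-ι v i)) (proj₂ (∈-filter⁻ (zero? (ι v)) {xs = List.allFin n} p))))
    (λ eq → ∈-filter⁺ (zero? (ι v)) (∈-allFin i) (trans (lookup-ι v i) (cong fromℤ eq)))

  Valid : Index n → Set
  Valid (inj₁ (i , j)) = lookup v i ≢ 0ℤ × lookup v j ≢ 0ℤ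
  Valid (inj₂ k)       = lookup v k ≡ 0ℤ

  index-valid : ∀ c → Valid (lookup index c)
  index-valid c = valid (∈-indices⁻ (ι v) (index-∈ c))
    where
    valid : ∀ {e} → (∃[ p ] p ∈ˡ pairs (support (ι v)) × e ≡ inj₁ p) ⊎
                    (∃[ k ] k ∈ˡ cosupport (ι v) × e ≡ inj₂ k) → Valid e
    valid (inj₁ ((i , j) , p , refl)) with q , r ← ∈-pairs⁻ (support (ι v)) p =
      to (∈-support i) q , to (∈-support j) r
    valid (inj₂ (k , p , refl)) = to (∈-cosupport k) p

  -- Each unordered pair of distinct positions is listed in one order only, hence the three cases.
  index-pair : ∀ {i j} → lookup v i ≢ 0ℤ → lookup v j ≢ 0ℤ →
               i ≡ j ⊎ (∃[ c ] lookup index c ≡ inj₁ (i , j)) ⊎ (∃[ c ] lookup index c ≡ inj₁ (j , i))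
  index-pair {i} {j} vᵢ≢0 vⱼ≢0 =
    Sum.map₂ (Sum.map (index-surjective ∘ ∈-indices⁺₁ (ι v)) (index-surjective ∘ ∈-indices⁺₁ (ι v)))
             (∈-pairs⁺ (from (∈-support i) vᵢ≢0) (from (∈-support j) vⱼ≢0))

  index-single : ∀ {k} → lookup v k ≡ 0ℤ → ∃[ c ] lookup index c ≡ inj₂ k
  index-single {k} vₖ≡0 = index-surjective (∈-indices⁺₂ (ι v) (from (∈-cosupport k) vₖ≡0))

  Quotients : Vec ℤ n → (Fin n → ℤ) → Set
  Quotients t q = ∀ i → lookup v i ≢ 0ℤ → lookup t i ≡ q i ℤ.* lookup v i

  quotients : ∀ t → v ∣ᵛ t → ∃ (Quotients t)
  quotients t v∣t = (λ i → proj₁ (quot i)) , λ i → proj₂ (quot i)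
    where
    quot : ∀ i → ∃[ q ] (lookup v i ≢ 0ℤ → lookup t i ≡ q ℤ.* lookup v i)
    quot i with lookup v i ℤ.≟ 0ℤ
    -- Off the support `Quotients` imposes nothing; 0 is an arbitrary default.
    ... | yes vᵢ≡0 = 0ℤ , λ vᵢ≢0 → ⊥-elim (vᵢ≢0 vᵢ≡0)
    ... | no  vᵢ≢0 with Signed.divides q eq ← Signed.∣ᵤ⇒∣ (v∣t i vᵢ≢0) = q , λ _ → eq

  -- The integral form of `L-entry`, with `q` in place of the quotients `tᵢ / vᵢ`.
  δ : Vec ℤ n → (Fin n → ℤ) → Index n → ℤ
  δ t q (inj₁ (i , j)) = q i ℤ.- q j
  δ t q (inj₂ k)       = lookup t k

  L-entry-δ : ∀ {t q} → Quotients t q → ∀ c → Valid c → L-entry (ι v) (ι t) c ≡ fromℤ (δ t q c)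
  L-entry-δ {t} {q} t≡qv (inj₁ (i , j)) (vᵢ≢0 , vⱼ≢0) = begin
    (lookup (ι t) i ⟋ lookup (ι v) i) ℚ.- (lookup (ι t) j ⟋ lookup (ι v) j)
      ≡⟨ cong₂ ℚ._-_ (quot vᵢ≢0) (quot vⱼ≢0) ⟩
    fromℤ (q i) ℚ.- fromℤ (q j)        ≡⟨ cong (fromℤ (q i) ℚ.+_) (fromℤ-neg (q j)) ⟨
    fromℤ (q i) ℚ.+ fromℤ (ℤ.- q j)    ≡⟨ fromℤ-+ (q i) (ℤ.- q j) ⟨
    fromℤ (q i ℤ.- q j)                ∎
    where
    open ≡-Reasoning
    quot : ∀ {i} → lookup v i ≢ 0ℤ → lookup (ι t) i ⟋ lookup (ι v) i ≡ fromℤ (q i)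
    quot {i} vᵢ≢0 = begin
      lookup (ι t) i ⟋ lookup (ι v) i
        ≡⟨ cong₂ _⟋_ (lookup-ι t i) (lookup-ι v i) ⟩
      fromℤ (lookup t i) ⟋ fromℤ (lookup v i)
        ≡⟨ cong (λ z → fromℤ z ⟋ fromℤ (lookup v i)) (t≡qv i vᵢ≢0) ⟩
      fromℤ (q i ℤ.* lookup v i) ⟋ fromℤ (lookup v i)
        ≡⟨ cong (_⟋ fromℤ (lookup v i)) (fromℤ-* (q i) (lookup v i)) ⟩
      (fromℤ (q i) ℚ.* fromℤ (lookup v i)) ⟋ fromℤ (lookup v i)
        ≡⟨ *-⟋ (fromℤ (q i)) (fromℤ (lookup v i)) (fromℤ≢0 vᵢ≢0) ⟩
      fromℤ (q i)
        ∎
  L-entry-δ {t} _ (inj₂ k) _ = lookup-ι t k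

  L-quotients : ∀ {t q} → Quotients t q → L (ι v) (ι t) ≡ ι (Vec.map (δ t q) index)
  L-quotients {t} {q} t≡qv = trans (L≡map (ι t)) (lookup-ext λ c → begin
    lookup (Vec.map (L-entry (ι v) (ι t)) index) c  ≡⟨ Vec.lookup-map c _ index ⟩
    L-entry (ι v) (ι t) (lookup index c)            ≡⟨ L-entry-δ t≡qv _ (index-valid c) ⟩
    fromℤ (δ t q (lookup index c))                  ≡⟨ cong fromℤ (Vec.lookup-map c _ index) ⟨
    fromℤ (lookup (Vec.map (δ t q) index) c)        ≡⟨ lookup-ι (Vec.map (δ t q) index) c ⟨
    lookup (ι (Vec.map (δ t q) index)) c            ∎)
    where open ≡-Reasoning

  -- L_v(t) = u, in terms of integers only.
  record Reduces (t : Vec ℤ n) (u : Vec ℤ m) : Set where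
    constructor reduces
    field
      quot       : Fin n → ℤ
      quotients≡ : Quotients t quot
      lookup≡δ   : ∀ c → lookup u c ≡ δ t quot (lookup index c)

  -- Divisibility makes `L_v(t)` integral, and `ι` is injective, so the equation over ℚ can be read
  -- over ℤ.
  L⇔reduces : ∀ {t u} → v ∣ᵛ t → L (ι v) (ι t) ≡ ι u ⇔ Reduces t u
  L⇔reduces {t} {u} v∣t = mk⇔ only-if if
    where
    q : ∃ (Quotients t)
    q = quotients t v∣t
    only-if : L (ι v) (ι t) ≡ ι u → Reduces t u
    only-if eq = reduces (proj₁ q) (proj₂ q) λ c →
      trans (cong (λ z → lookup z c) (ι-injective (trans (sym eq) (L-quotients (proj₂ q)))))
            (Vec.lookup-map c _ index)
    if : Reduces t u → L (ι v) (ι t) ≡ ι u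
    if (reduces q t≡qv u≗δ) = trans (L-quotients t≡qv)
      (cong ι (lookup-ext λ c → trans (Vec.lookup-map c _ index) (sym (u≗δ c))))

  -- All quotients `vᵢ / vᵢ` are 1, so their differences vanish, and off the support `v` itself is
  -- 0.
  reduces-v : Reduces v 𝟘
  reduces-v = reduces (λ _ → 1ℤ) (λ i _ → sym (ℤ.*-identityˡ _)) λ c → trans (lookup-𝟘 c) (sym (zero-δ _ (index-valid c)))
    where
    zero-δ : ∀ c → Valid c → δ v (λ _ → 1ℤ) c ≡ 0ℤ
    zero-δ (inj₁ _) _    = refl
    zero-δ (inj₂ k) vₖ≡0 = vₖ≡0

  reduces-𝟘 : Reduces 𝟘 𝟘
  reduces-𝟘 = reduces (λ _ → 0ℤ) (λ i _ → lookup-𝟘 i) λ c → trans (lookup-𝟘 c) (sym (zero-δ (lookup index c)))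
    where
    zero-δ : ∀ c → δ 𝟘 (λ _ → 0ℤ) c ≡ 0ℤ
    zero-δ (inj₁ _) = refl
    zero-δ (inj₂ k) = lookup-𝟘 k

  -- Linearity of `L_v`, in the shape of the recursion of `combination`: quotients combine with the
  -- same coefficients as the vectors.
  reduces-·⊕ : ∀ k {t u t′ u′} → Reduces t u → Reduces t′ u′ → Reduces ((k · t) ⊕ t′) ((k · u) ⊕ u′)
  reduces-·⊕ k {t} {u} {t′} {u′} (reduces q t≡qv u≗δ) (reduces q′ t′≡qv u′≗δ) =
    reduces q″ quot λ c → trans (lookup-·⊕ u u′ c)
           (trans (cong₂ (λ x y → k ℤ.* x ℤ.+ y) (u≗δ c) (u′≗δ c)) (linear-δ (lookup index c)))
    where
    q″ : Fin n → ℤ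
    q″ i = k ℤ.* q i ℤ.+ q′ i
    lookup-·⊕ : ∀ {d} (x y : Vec ℤ d) i → lookup ((k · x) ⊕ y) i ≡ k ℤ.* lookup x i ℤ.+ lookup y i
    lookup-·⊕ x y i = trans (lookup-⊕ (k · x) y i) (cong (ℤ._+ lookup y i) (lookup-· k x i))
    quot : Quotients ((k · t) ⊕ t′) q″
    quot i vᵢ≢0 = trans (lookup-·⊕ t t′ i)
      (trans (cong₂ (λ x y → k ℤ.* x ℤ.+ y) (t≡qv i vᵢ≢0) (t′≡qv i vᵢ≢0)) (eq k (q i) (q′ i) (lookup v i)))
      where
      eq : ∀ k q q′ v → k ℤ.* (q ℤ.* v) ℤ.+ q′ ℤ.* v ≡ (k ℤ.* q ℤ.+ q′) ℤ.* v
      eq = solve-∀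
    linear-δ : ∀ c → k ℤ.* δ t q c ℤ.+ δ t′ q′ c ≡ δ ((k · t) ⊕ t′) q″ c
    linear-δ (inj₁ (i , j)) = eq k (q i) (q j) (q′ i) (q′ j)
      where
      eq : ∀ k q r q′ r′ → k ℤ.* (q ℤ.- r) ℤ.+ (q′ ℤ.- r′) ≡ (k ℤ.* q ℤ.+ q′) ℤ.- (k ℤ.* r ℤ.+ r′)
      eq = solve-∀
    linear-δ (inj₂ i) = sym (lookup-·⊕ t t′ i)

  -- On the support `q i * vᵢ = 0` forces `q i = 0`, and valid labels consult `q` only there.
  reduces-𝟘⇒≡𝟘 : ∀ {u} → Reduces 𝟘 u → u ≡ 𝟘
  reduces-𝟘⇒≡𝟘 {u} (reduces q 𝟘≡qv u≗δ) =
    lookup-ext λ c → trans (u≗δ c) (trans (zero-δ _ (index-valid c)) (sym (lookup-𝟘 c)))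
    where
    q≡0 : ∀ {i} → lookup v i ≢ 0ℤ → q i ≡ 0ℤ
    q≡0 {i} vᵢ≢0 with ℤ.i*j≡0⇒i≡0∨j≡0 (q i) (trans (sym (𝟘≡qv i vᵢ≢0)) (lookup-𝟘 i))
    ... | inj₁ qᵢ≡0 = qᵢ≡0
    ... | inj₂ vᵢ≡0 = ⊥-elim (vᵢ≢0 vᵢ≡0)
    zero-δ : ∀ c → Valid c → δ 𝟘 q c ≡ 0ℤ
    zero-δ (inj₁ (i , j)) (vᵢ≢0 , vⱼ≢0) = cong₂ ℤ._-_ (q≡0 vᵢ≢0) (q≡0 vⱼ≢0)
    zero-δ (inj₂ k)       _             = lookup-𝟘 k

-- Boxes

InBox : Vec ℤ n → Vec ℤ n → Vec ℤ n → Set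
InBox a b x = ∀ i → lookup a i ≤ lookup x i × lookup x i ≤ lookup b i

lookup-interleaveˡ : ∀ (a b : Vec ℤ n) i → lookup (interleave a b) (combine i zero) ≡ lookup a i
lookup-interleaveˡ (_ ∷ _)  (_ ∷ _)  zero    = refl
lookup-interleaveˡ (_ ∷ as) (_ ∷ bs) (suc i) = lookup-interleaveˡ as bs i

lookup-interleaveʳ : ∀ (a b : Vec ℤ n) i → lookup (interleave a b) (combine i (suc zero)) ≡ lookup b i
lookup-interleaveʳ (_ ∷ _)  (_ ∷ _)  zero    = refl
lookup-interleaveʳ (_ ∷ as) (_ ∷ bs) (suc i) = lookup-interleaveʳ as bs i

-- Positions within an interleaved pair `aᵢ , bᵢ`. Division by a negative number exchanges the two
-- ends; the value at 0 is a default.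
lowerSide upperSide : ℤ → Fin 2
lowerSide (+ _)    = zero
lowerSide -[1+ _ ] = suc zero
upperSide (+ _)    = suc zero
upperSide -[1+ _ ] = zero

divide-bounds : ∀ {m} → m ≢ 0ℤ → ∀ (z : Fin 2 → ℤ) q →
  (z zero ≤ q ℤ.* m × q ℤ.* m ≤ z (suc zero)) ⇔
  (⌈ z (lowerSide m) ÷ m ⌉ ≤ q × q ≤ ⌊ z (upperSide m) ÷ m ⌋)
divide-bounds {+0}       m≢0 _ _ = ⊥-elim (m≢0 refl)
divide-bounds {+[1+ n ]} _   z q = mk⇔
  (λ (l , u) → from (⌈÷pos⌉≤ n q (z zero)) l , from (≤⌊÷pos⌋ n q (z (suc zero))) u)
  (λ (l , u) → to (⌈÷pos⌉≤ n q (z zero)) l , to (≤⌊÷pos⌋ n q (z (suc zero))) u)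
divide-bounds { -[1+ n ]} _  z q = mk⇔
  (λ (l , u) → from (⌈÷neg⌉≤ n q (z (suc zero))) u , from (≤⌊÷neg⌋ n q (z zero)) l)
  (λ (l , u) → to (≤⌊÷neg⌋ n q (z zero)) u , to (⌈÷neg⌉≤ n q (z (suc zero))) l)

neg-minus : ∀ x y → ℤ.- (x ℤ.- y) ≡ y ℤ.- x
neg-minus = solve-∀

minus-plus : ∀ x y → (x ℤ.- y) ℤ.+ y ≡ x
minus-plus = solve-∀

module ReducedBox {n} (v : Vec ℤ n) where
  open Reduction v

  lower upper : Fin n → Vec ℤ (n ℕ.* 2) → ℤ
  lower i z = ⌈ lookup z (combine i (lowerSide (lookup v i))) ÷ lookup v i ⌉
  upper i z = ⌊ lookup z (combine i (upperSide (lookup v i))) ÷ lookup v i ⌋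

  -- On pairs this is interval subtraction: the range of `qᵢ - qⱼ` when both quotients run through
  -- their own intervals.
  lower′ upper′ : Index n → Vec ℤ (n ℕ.* 2) → ℤ
  lower′ (inj₁ (i , j)) z = lower i z ℤ.- upper j z
  lower′ (inj₂ k)       z = lookup z (combine k zero)
  upper′ (inj₁ (i , j)) z = upper i z ℤ.- lower j z
  upper′ (inj₂ k)       z = lookup z (combine k (suc zero))

  lowers uppers : Vec ℤ (n ℕ.* 2) → Vec ℤ m
  lowers z = Vec.map (λ c → lower′ c z) index
  uppers z = Vec.map (λ c → upper′ c z) index

  lookup-lowers : ∀ z c → lookup (lowers z) c ≡ lower′ (lookup index c) z
  lookup-lowers z c = Vec.lookup-map c _ index

  lookup-uppers : ∀ z c → lookup (uppers z) c ≡ upper′ (lookup index c) z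
  lookup-uppers z c = Vec.lookup-map c _ index

  Feasible : Vec ℤ (n ℕ.* 2) → Set
  Feasible z = ∀ i → lookup v i ≢ 0ℤ → lower i z ≤ upper i z

  InReducedBox : Vec ℤ (n ℕ.* 2) → Vec ℤ m → Set
  InReducedBox z = InBox (lowers z) (uppers z)

  reducedBox⇔ : ∀ z u → InReducedBox z u ⇔
    (∀ c → lower′ (lookup index c) z ≤ lookup u c × lookup u c ≤ upper′ (lookup index c) z)
  reducedBox⇔ z u = mk⇔
    (λ h c → subst (_≤ lookup u c) (lookup-lowers z c) (proj₁ (h c)) ,
             subst (lookup u c ≤_) (lookup-uppers z c) (proj₂ (h c)))
    (λ h c → subst (_≤ lookup u c) (sym (lookup-lowers z c)) (proj₁ (h c)) ,
             subst (lookup u c ≤_) (sym (lookup-uppers z c)) (proj₂ (h c)))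

  module _ (a b : Vec ℤ n) where
    private
      z : Vec ℤ (n ℕ.* 2)
      z = interleave a b

    quotient-bounds : ∀ {i x} q → lookup v i ≢ 0ℤ → x ≡ q ℤ.* lookup v i →
      (lookup a i ≤ x × x ≤ lookup b i) ⇔ (lower i z ≤ q × q ≤ upper i z)
    quotient-bounds {i} q vᵢ≢0 refl =
      subst₂ (λ s t → (s ≤ q ℤ.* lookup v i × q ℤ.* lookup v i ≤ t) ⇔ (lower i z ≤ q × q ≤ upper i z))
        (lookup-interleaveˡ a b i) (lookup-interleaveʳ a b i)
        (divide-bounds vᵢ≢0 (λ s → lookup z (combine i s)) q)

    -- The recursive criterion applies only to boxes with ordered ends. On pair coordinates the
    -- order comes from feasibility, on the others from `a ≤ b`.
    reducedBox-ordered : (∀ i → lookup a i ≤ lookup b i) → Feasible z →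
                         ∀ c → lookup (lowers z) c ≤ lookup (uppers z) c
    reducedBox-ordered a≤b feas c =
      subst₂ _≤_ (sym (lookup-lowers z c)) (sym (lookup-uppers z c)) (ordered _ (index-valid c))
      where
      ordered : ∀ e → Valid e → lower′ e z ≤ upper′ e z
      ordered (inj₁ (i , j)) (vᵢ≢0 , vⱼ≢0) = ℤ.+-mono-≤ (feas i vᵢ≢0) (ℤ.neg-mono-≤ (feas j vⱼ≢0))
      ordered (inj₂ k) _ =
        subst₂ _≤_ (sym (lookup-interleaveˡ a b k)) (sym (lookup-interleaveʳ a b k)) (a≤b k)

    box⇒reducedBox : ∀ {x u} → Reduces x u → InBox a b x → Feasible z × InReducedBox z u
    box⇒reducedBox {x} {u} (reduces q x≡qv u≗δ) x∈ = feas , from (reducedBox⇔ z u) bounded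
      where
      bounds : ∀ i → lookup v i ≢ 0ℤ → lower i z ≤ q i × q i ≤ upper i z
      bounds i vᵢ≢0 = to (quotient-bounds (q i) vᵢ≢0 (x≡qv i vᵢ≢0)) (x∈ i)
      feas : Feasible z
      feas i vᵢ≢0 = ℤ.≤-trans (proj₁ (bounds i vᵢ≢0)) (proj₂ (bounds i vᵢ≢0))
      δ-bounded : ∀ e → Valid e → lower′ e z ≤ δ x q e × δ x q e ≤ upper′ e z
      δ-bounded (inj₁ (i , j)) (vᵢ≢0 , vⱼ≢0)
        with lᵢ , uᵢ ← bounds i vᵢ≢0 | lⱼ , uⱼ ← bounds j vⱼ≢0 =
        ℤ.+-mono-≤ lᵢ (ℤ.neg-mono-≤ uⱼ) , ℤ.+-mono-≤ uᵢ (ℤ.neg-mono-≤ lⱼ)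
      δ-bounded (inj₂ k) _ =
        subst (_≤ lookup x k) (sym (lookup-interleaveˡ a b k)) (proj₁ (x∈ k)) ,
        subst (lookup x k ≤_) (sym (lookup-interleaveʳ a b k)) (proj₂ (x∈ k))
      bounded : ∀ c → lower′ (lookup index c) z ≤ lookup u c × lookup u c ≤ upper′ (lookup index c) z
      bounded c = subst (λ y → lower′ (lookup index c) z ≤ y × y ≤ upper′ (lookup index c) z)
                        (sym (u≗δ c)) (δ-bounded _ (index-valid c))

    -- The k sought lie in the intervals [lower i - q i , upper i - q i]; these
    -- have a common point because any two of them meet.
    reducedBox⇒box : ∀ {t u} → Reduces t u → Feasible z → InReducedBox z u →
                     ∃[ k ] InBox a b ((k · v) ⊕ t)
    reducedBox⇒box {t} {u} (reduces q t≡qv u≗δ) feas u∈ = k , inBox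
      where
      δ-bounded : ∀ {e} → (∃[ c ] lookup index c ≡ e) → lower′ e z ≤ δ t q e × δ t q e ≤ upper′ e z
      δ-bounded (c , refl) = subst (λ y → lower′ (lookup index c) z ≤ y × y ≤ upper′ (lookup index c) z)
                                   (u≗δ c) (to (reducedBox⇔ z u) u∈ c)
      meet : ∀ {i j} → lookup v i ≢ 0ℤ → lookup v j ≢ 0ℤ → lower i z ℤ.- q i ≤ upper j z ℤ.- q j
      -- A pair listed as `(i , j)` gives the claim through its lower bound, one listed as `(j , i)`
      -- through its upper bound; the case `i = j` is feasibility.
      meet {i} {j} vᵢ≢0 vⱼ≢0 with index-pair vᵢ≢0 vⱼ≢0
      ... | inj₁ refl       = ℤ.+-monoˡ-≤ (ℤ.- q i) (feas i vᵢ≢0)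
      ... | inj₂ (inj₁ ij∈) = ≤-transposeʳ (lower i z) (upper j z) (q i) (q j) (proj₁ (δ-bounded ij∈))
      ... | inj₂ (inj₂ ji∈) = ≤-transposeˡ (q j) (q i) (upper j z) (lower i z) (proj₂ (δ-bounded ji∈))
      point : ∃[ k ] _
      point = common-point (λ i → lower i z ℤ.- q i) (λ i → upper i z ℤ.- q i) (support (ι v))
                (λ i∈ j∈ → meet (to (∈-support _) i∈) (to (∈-support _) j∈))
      k : ℤ
      k = proj₁ point
      lookup-x : ∀ i → lookup ((k · v) ⊕ t) i ≡ k ℤ.* lookup v i ℤ.+ lookup t i
      lookup-x i = trans (lookup-⊕ (k · v) t i) (cong (ℤ._+ lookup t i) (lookup-· k v i))
      off-support : ∀ i → lookup v i ≡ 0ℤ → lookup ((k · v) ⊕ t) i ≡ lookup t i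
      off-support i vᵢ≡0 = trans (lookup-x i) (trans (cong (λ w → k ℤ.* w ℤ.+ lookup t i) vᵢ≡0)
        (trans (cong (ℤ._+ lookup t i) (ℤ.*-zeroʳ k)) (ℤ.+-identityˡ _)))
      on-support : ∀ i → lookup v i ≢ 0ℤ → lookup ((k · v) ⊕ t) i ≡ (k ℤ.+ q i) ℤ.* lookup v i
      on-support i vᵢ≢0 = trans (lookup-x i) (trans (cong (λ w → k ℤ.* lookup v i ℤ.+ w) (t≡qv i vᵢ≢0))
        (sym (ℤ.*-distribʳ-+ (lookup v i) k (q i))))
      k-bounds : ∀ i → lookup v i ≢ 0ℤ → lower i z ≤ k ℤ.+ q i × k ℤ.+ q i ≤ upper i z
      k-bounds i vᵢ≢0 =
        subst (_≤ k ℤ.+ q i) (minus-plus (lower i z) (q i)) (ℤ.+-monoˡ-≤ (q i) (proj₁ k-ok)) ,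
        subst (k ℤ.+ q i ≤_) (minus-plus (upper i z) (q i)) (ℤ.+-monoˡ-≤ (q i) (proj₂ k-ok))
        where
        k-ok : lower i z ℤ.- q i ≤ k × k ≤ upper i z ℤ.- q i
        k-ok = proj₂ point (from (∈-support i) vᵢ≢0)
      inBoxAt : ∀ i → Dec (lookup v i ≡ 0ℤ) →
                lookup a i ≤ lookup ((k · v) ⊕ t) i × lookup ((k · v) ⊕ t) i ≤ lookup b i
      inBoxAt i (yes vᵢ≡0) = subst (λ y → lookup a i ≤ y × y ≤ lookup b i) (sym (off-support i vᵢ≡0))
        (subst₂ (λ l u → l ≤ lookup t i × lookup t i ≤ u)
          (lookup-interleaveˡ a b i) (lookup-interleaveʳ a b i) (δ-bounded (index-single vᵢ≡0)))
      inBoxAt i (no vᵢ≢0) =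
        from (quotient-bounds (k ℤ.+ q i) vᵢ≢0 (on-support i vᵢ≢0)) (k-bounds i vᵢ≢0)
      inBox : InBox a b ((k · v) ⊕ t)
      inBox i = inBoxAt i (lookup v i ℤ.≟ 0ℤ)

  -- Mod-linearity of the reduced bounds and of the tests on them

  upper-lower-linear : ∀ i j → lookup v i ≢ 0ℤ → lookup v j ≢ 0ℤ →
                       ModLinear 1 (λ z → upper i z ℤ.- lower j z)
  upper-lower-linear i j vᵢ≢0 vⱼ≢0 =
    floor-ceiling vᵢ≢0 vⱼ≢0 (projection _ λ _ → refl) (projection _ λ _ → refl)

  lower′-floors : ∀ e → Valid e → FloorsOfOrder 1 (lower′ e)
  lower′-floors (inj₁ (i , j)) (vᵢ≢0 , vⱼ≢0) =
    floors-resp (λ z → neg-minus (upper j z) (lower i z))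
                (floors-neg (floors (upper-lower-linear j i vⱼ≢0 vᵢ≢0)))
  lower′-floors (inj₂ k) _ = floors-suc (projection _ λ _ → refl)

  upper′-floors : ∀ e → Valid e → FloorsOfOrder 1 (upper′ e)
  upper′-floors (inj₁ (i , j)) (vᵢ≢0 , vⱼ≢0) = floors (upper-lower-linear i j vᵢ≢0 vⱼ≢0)
  upper′-floors (inj₂ k) _ = floors-suc (projection _ λ _ → refl)

  reducedBounds : Vec ℤ (n ℕ.* 2) → Vec ℤ (m ℕ.* 2)
  reducedBounds z = interleave (lowers z) (uppers z)

  reducedBounds-floors : ∀ p → FloorsOfOrder 1 (λ z → lookup (reducedBounds z) p)
  reducedBounds-floors p with Fin.combine-surjective {m} {2} p
  ... | c , zero , refl = floors-resp
    (λ z → sym (trans (lookup-interleaveˡ (lowers z) (uppers z) c) (lookup-lowers z c)))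
    (lower′-floors _ (index-valid c))
  ... | c , suc zero , refl = floors-resp
    (λ z → sym (trans (lookup-interleaveʳ (lowers z) (uppers z) c) (lookup-uppers z c)))
    (upper′-floors _ (index-valid c))

  -- On pairs, `lᵢ - uⱼ ≤ 0` is tested as `0 ≤ uⱼ - lᵢ`, which is a floor minus a ceiling and so of
  -- order 1.
  nonpos-lower′ : ∀ e → Valid e → ∃[ l ] ModLinear 1 l × (∀ z → 0ℤ ≤ l z ⇔ lower′ e z ≤ 0ℤ)
  nonpos-lower′ (inj₁ (i , j)) (vᵢ≢0 , vⱼ≢0) = _ , upper-lower-linear j i vⱼ≢0 vᵢ≢0 ,
    λ z → mk⇔ (λ h → subst (_≤ 0ℤ) (neg-minus (upper j z) (lower i z)) (ℤ.neg-mono-≤ h))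
              (λ h → subst (0ℤ ≤_) (neg-minus (lower i z) (upper j z)) (ℤ.neg-mono-≤ h))
  nonpos-lower′ (inj₂ k) _ = nonpos-test (combine k zero)

  nonneg-upper′ : ∀ e → Valid e → ∃[ l ] ModLinear 1 l × (∀ z → 0ℤ ≤ l z ⇔ 0ℤ ≤ upper′ e z)
  nonneg-upper′ (inj₁ (i , j)) (vᵢ≢0 , vⱼ≢0) = _ , upper-lower-linear i j vᵢ≢0 vⱼ≢0 , λ _ → mk⇔ (λ h → h) (λ h → h)
  nonneg-upper′ (inj₂ k) _ = nonneg-test (combine k (suc zero))

  NonNegAt : Vec ℤ (n ℕ.* 2) → (Vec ℤ (n ℕ.* 2) → ℤ) → Set
  NonNegAt z l = 0ℤ ≤ l z

  feasibility : List (Vec ℤ (n ℕ.* 2) → ℤ)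
  feasibility = List.map (λ i z → upper i z ℤ.- lower i z) (support (ι v))

  feasibility-linear : All (ModLinear 1) feasibility
  feasibility-linear = AllL.map⁺ (AllL.tabulate λ {i} i∈ →
    upper-lower-linear i i (to (∈-support i) i∈) (to (∈-support i) i∈))

  feasibility⇔ : ∀ z → All (NonNegAt z) feasibility ⇔ Feasible z
  feasibility⇔ z = mk⇔
    (λ h i vᵢ≢0 → ℤ.0≤i-j⇒j≤i (AllL.lookup (AllL.map⁻ h) (from (∈-support i) vᵢ≢0)))
    (λ h → AllL.map⁺ (AllL.tabulate λ {i} i∈ → ℤ.i≤j⇒0≤j-i (h i (to (∈-support i) i∈))))

  -- For the base case `L_v(A) = {0}`, where the reduced box need only contain the origin.
  𝟘-tests : List (Vec ℤ (n ℕ.* 2) → ℤ)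
  𝟘-tests = List.tabulate (λ c → proj₁ (nonpos-lower′ _ (index-valid c)))
         ++ List.tabulate (λ c → proj₁ (nonneg-upper′ _ (index-valid c)))

  𝟘-tests-linear : All (ModLinear 1) 𝟘-tests
  𝟘-tests-linear = AllL.++⁺
    (AllL.tabulate⁺ λ c → proj₁ (proj₂ (nonpos-lower′ _ (index-valid c))))
    (AllL.tabulate⁺ λ c → proj₁ (proj₂ (nonneg-upper′ _ (index-valid c))))

  𝟘-tests⇔ : ∀ z → All (NonNegAt z) 𝟘-tests ⇔ InReducedBox z 𝟘
  𝟘-tests⇔ z = mk⇔ only-if if
    where
    only-if : All (NonNegAt z) 𝟘-tests → InReducedBox z 𝟘
    only-if h = from (reducedBox⇔ z 𝟘) λ c →
      subst (lower′ (lookup index c) z ≤_) (sym (lookup-𝟘 c))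
        (to (proj₂ (proj₂ (nonpos-lower′ _ (index-valid c))) z) (AllL.tabulate⁻ (proj₁ (AllL.++⁻ _ h)) c)) ,
      subst (_≤ upper′ (lookup index c) z) (sym (lookup-𝟘 c))
        (to (proj₂ (proj₂ (nonneg-upper′ _ (index-valid c))) z) (AllL.tabulate⁻ (proj₂ (AllL.++⁻ _ h)) c))
    if : InReducedBox z 𝟘 → All (NonNegAt z) 𝟘-tests
    if h = AllL.++⁺
      (AllL.tabulate⁺ λ c → from (proj₂ (proj₂ (nonpos-lower′ _ (index-valid c))) z)
        (subst (lower′ (lookup index c) z ≤_) (lookup-𝟘 c) (proj₁ (to (reducedBox⇔ z 𝟘) h c))))
      (AllL.tabulate⁺ λ c → from (proj₂ (proj₂ (nonneg-upper′ _ (index-valid c))) z)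
        (subst (_≤ upper′ (lookup index c) z) (lookup-𝟘 c) (proj₂ (to (reducedBox⇔ z 𝟘) h c))))

-- Addition and multiples of vectors

⊕-identityˡ : ∀ (x : Vec ℤ n) → 𝟘 ⊕ x ≡ x
⊕-identityˡ x = lookup-ext λ i → trans (lookup-⊕ 𝟘 x i)
  (trans (cong (ℤ._+ lookup x i) (lookup-𝟘 i)) (ℤ.+-identityˡ _))

⊕-identityʳ : ∀ (x : Vec ℤ n) → x ⊕ 𝟘 ≡ x
⊕-identityʳ x = lookup-ext λ i → trans (lookup-⊕ x 𝟘 i)
  (trans (cong (λ y → lookup x i ℤ.+ y) (lookup-𝟘 i)) (ℤ.+-identityʳ _))

·-zeroˡ : ∀ (x : Vec ℤ n) → 0ℤ · x ≡ 𝟘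
·-zeroˡ x = lookup-ext λ i → trans (lookup-· 0ℤ x i) (sym (lookup-𝟘 i))

·-zeroʳ : ∀ k → k · 𝟘 ≡ 𝟘 {n}
·-zeroʳ k = lookup-ext λ i → trans (lookup-· k 𝟘 i)
  (trans (cong (k ℤ.*_) (lookup-𝟘 i)) (trans (ℤ.*-zeroʳ k) (sym (lookup-𝟘 i))))

·-suc : ∀ k (x : Vec ℤ n) → (+ suc k) · x ≡ x ⊕ ((+ k) · x)
·-suc k x = lookup-ext λ i → trans (lookup-· (+ suc k) x i)
  (trans (ℤ.suc-* (+ k) (lookup x i))
    (sym (trans (lookup-⊕ x ((+ k) · x) i) (cong (λ y → lookup x i ℤ.+ y) (lookup-· (+ k) x i)))))

·-neg : ∀ k (x : Vec ℤ n) → (ℤ.- k) · x ≡ ⊖ (k · x)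
·-neg k x = lookup-ext λ i → trans (lookup-· (ℤ.- k) x i)
  (sym (trans (Vec.lookup-map i ℤ.-_ (k · x))
    (trans (cong ℤ.-_ (lookup-· k x i)) (ℤ.neg-distribˡ-* k (lookup x i)))))

·-cancel : ∀ {k} {x : Vec ℤ n} → x ≢ 𝟘 → k · x ≡ 𝟘 → k ≡ 0ℤ
·-cancel {k = k} {x} x≢𝟘 kx≡𝟘 with k ℤ.≟ 0ℤ
... | yes k≡0 = k≡0
... | no  k≢0 = ⊥-elim (x≢𝟘 (lookup-ext λ i → trans (xᵢ≡0 i) (sym (lookup-𝟘 i))))
  where
  xᵢ≡0 : ∀ i → lookup x i ≡ 0ℤ
  xᵢ≡0 i with ℤ.i*j≡0⇒i≡0∨j≡0 k
                (trans (sym (lookup-· k x i)) (trans (cong (λ y → lookup y i) kx≡𝟘) (lookup-𝟘 i)))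
  ... | inj₁ k≡0 = ⊥-elim (k≢0 k≡0)
  ... | inj₂ eq  = eq

combination-𝟘 : ∀ {k} (ws : Vec (Vec ℤ n) k) → combination 𝟘 ws ≡ 𝟘
combination-𝟘 []       = refl
combination-𝟘 (w ∷ ws) = trans (cong₂ _⊕_ (·-zeroˡ w) (combination-𝟘 ws)) (⊕-identityˡ 𝟘)

·-closed : ∀ {ℓ} {A : Pred (Vec ℤ n) ℓ} → IsSubgroup A → ∀ k {x} → x ∈ A → k · x ∈ A
·-closed {A = A} sub = λ
  { (+ k)      {x} x∈A → multiple k x∈A
  ; (-[1+ k ]) {x} x∈A → subst A (sym (·-neg (+ suc k) x)) (⊖-closed (multiple (suc k) x∈A)) }
  where
  open IsSubgroup sub
  multiple : ∀ k {x} → x ∈ A → (+ k) · x ∈ A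
  multiple zero    {x} x∈A = subst A (sym (·-zeroˡ x)) 𝟘-mem
  multiple (suc k) {x} x∈A = subst A (sym (·-suc k x)) (⊕-closed x∈A (multiple k x∈A))

-- Rank

-- With `k = suc r` this is the upper bound in `HasRank`, the form in which the rank passes through
-- the recursion.
Dependent : ∀ {ℓ} → Pred (Vec ℤ n) ℓ → ℕ → Set ℓ
Dependent {n} A k = ∀ (ws : Vec (Vec ℤ n) k) → AllV.All A ws → ¬ Independent ws

module _ {n ℓ} {A : Pred (Vec ℤ n) ℓ} (v : Vec ℤ n) (v≢𝟘 : v ≢ 𝟘) (v∣A : ∀ w → w ∈ A → v ∣ᵛ w) where
  open Reduction v

  preimages : ∀ {k} {us : Vec (Vec ℤ m) k} → AllV.All (L-image v A) us →
    Σ[ ts ∈ Vec (Vec ℤ n) k ] AllV.All A ts × (∀ cs → Reduces (combination cs ts) (combination cs us))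
  preimages [] = [] , [] , λ { [] → reduces-𝟘 }
  preimages ((t , t∈A , Lt≡u) ∷ us∈) =
    t ∷ proj₁ tail , t∈A ∷ proj₁ (proj₂ tail) ,
    λ { (c ∷ cs) → reduces-·⊕ c (to (L⇔reduces (v∣A t t∈A)) Lt≡u) (proj₂ (proj₂ tail) cs) }
    where
    tail = preimages us∈

  -- Apply `L_v` to a vanishing combination: `v` goes to 0, so independence of `us` kills the
  -- coefficients `cs`. What remains is `c · v = 𝟘`, and `v` is nonzero.
  independent-∷ : ∀ {k} {ts : Vec (Vec ℤ n) k} {us : Vec (Vec ℤ m) k} →
    (∀ cs → Reduces (combination cs ts) (combination cs us)) → Independent us → Independent (v ∷ ts)
  independent-∷ {ts = ts} {us} red us-ind (c ∷ cs) eq = cong₂ _∷_ c≡0 cs≡𝟘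
    where
    cs≡𝟘 : cs ≡ 𝟘
    cs≡𝟘 = us-ind cs (begin
      combination cs us              ≡⟨ ⊕-identityˡ _ ⟨
      𝟘 ⊕ combination cs us          ≡⟨ cong (_⊕ combination cs us) (·-zeroʳ c) ⟨
      (c · 𝟘) ⊕ combination cs us    ≡⟨ reduces-𝟘⇒≡𝟘 (subst (λ t → Reduces t ((c · 𝟘) ⊕ combination cs us)) eq
                                          (reduces-·⊕ c reduces-v (red cs))) ⟩
      𝟘                              ∎)
      where open ≡-Reasoning
    c≡0 : c ≡ 0ℤ
    c≡0 = ·-cancel v≢𝟘 (begin
      c · v                                 ≡⟨ ⊕-identityʳ _ ⟨
      (c · v) ⊕ 𝟘                           ≡⟨ cong ((c · v) ⊕_) (combination-𝟘 ts) ⟨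
      (c · v) ⊕ combination 𝟘 ts            ≡⟨ cong (λ ds → (c · v) ⊕ combination ds ts) cs≡𝟘 ⟨
      (c · v) ⊕ combination cs ts           ≡⟨ eq ⟩
      𝟘                                     ∎)
      where open ≡-Reasoning

  -- The rank drops: `k` independent elements of the image lift to `A` and stay independent when `v`
  -- is added.
  dependent-image : v ∈ A → ∀ {k} → Dependent A (suc k) → Dependent (L-image v A) k
  dependent-image v∈A dep us us∈ us-ind =
    dep _ (v∈A ∷ proj₁ (proj₂ ts)) (independent-∷ (proj₂ (proj₂ ts)) us-ind)
    where
    ts = preimages us∈

-- The case `k = 0`: the empty family in the image is independent, so `v` alone is independent in
-- `A`.
𝓔⇒rank≢0 : ∀ {ℓ} {A : Pred (Vec ℤ n) ℓ} → 𝓔 A → ¬ Dependent A 1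
𝓔⇒rank≢0 (mk _ v v∈A v≢𝟘 v∣A _) dep = dependent-image v v≢𝟘 v∣A v∈A dep [] [] λ { [] _ → refl }

-- The recursive construction of the finite set of tests

Criterion : ∀ {ℓ} → Pred (Vec ℤ n) ℓ → ℕ → Set ℓ
Criterion {n} A r = Σ[ E ∈ List (Vec ℤ (n ℕ.* 2) → ℤ) ] (All (ModLinear r) E ×
  (∀ (a b : Vec ℤ n) → (∀ i → lookup a i ≤ lookup b i) →
    (∃[ x ] (x ∈ A × InBox a b x)) ⇔ All (λ l → 0ℤ ≤ l (interleave a b)) E))

module _ {n ℓ} {A : Pred (Vec ℤ n) ℓ} (sub : IsSubgroup A) (v : Vec ℤ n) (v∈A : v ∈ A)
         (v∣A : ∀ w → w ∈ A → v ∣ᵛ w) where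
  open IsSubgroup sub
  open Reduction v
  open ReducedBox v

  -- One way, `u` is `L_v(x)`. The other way, a preimage of `u` is translated into the box by a
  -- multiple of `v`, which does not leave `A`.
  box⇔reducedBox : ∀ a b → (∃[ x ] (x ∈ A × InBox a b x)) ⇔
    (Feasible (interleave a b) × (∃[ u ] (u ∈ L-image v A × InReducedBox (interleave a b) u)))
  box⇔reducedBox a b = mk⇔ only-if if
    where
    only-if : (∃[ x ] (x ∈ A × InBox a b x)) →
      Feasible (interleave a b) × (∃[ u ] (u ∈ L-image v A × InReducedBox (interleave a b) u))
    only-if (x , x∈A , x∈) = proj₁ fu , u , (x , x∈A , from (L⇔reduces (v∣A x x∈A)) red) , proj₂ fu
      where
      q : ∃ (Quotients x)
      q = quotients x (v∣A x x∈A)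
      u : Vec ℤ m
      u = Vec.map (δ x (proj₁ q)) index
      red : Reduces x u
      red = reduces (proj₁ q) (proj₂ q) λ c → Vec.lookup-map c (δ x (proj₁ q)) index
      fu : Feasible (interleave a b) × InReducedBox (interleave a b) u
      fu = box⇒reducedBox a b red x∈
    if : Feasible (interleave a b) × (∃[ u ] (u ∈ L-image v A × InReducedBox (interleave a b) u)) →
         ∃[ x ] (x ∈ A × InBox a b x)
    if (feas , u , (t , t∈A , Lt≡u) , u∈) =
      (proj₁ k · v) ⊕ t , ⊕-closed (·-closed sub (proj₁ k) v∈A) t∈A , proj₂ k
      where
      k : ∃[ k ] InBox a b ((k · v) ⊕ t)
      k = reducedBox⇒box a b (to (L⇔reduces (v∣A t t∈A)) Lt≡u) feas u∈

  criterion-𝟘 : (∀ t → t ∈ A → L (ι v) (ι t) ≡ replicate _ 0ℚ) → ∀ r → Criterion A (suc r)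
  criterion-𝟘 L≡0 r =
    feasibility ++ 𝟘-tests ,
    AllL.map (λ p → ModLinear-1≤ p r) (AllL.++⁺ feasibility-linear 𝟘-tests-linear) ,
    λ a b _ → mk⇔ (only-if a b) (if a b)
    where
    L≡ι𝟘 : ∀ t → t ∈ A → L (ι v) (ι t) ≡ ι 𝟘
    L≡ι𝟘 t t∈A = trans (L≡0 t t∈A) (sym (Vec.map-replicate fromℤ 0ℤ _))
    image≡𝟘 : ∀ u → u ∈ L-image v A → u ≡ 𝟘
    image≡𝟘 u (t , t∈A , Lt≡u) = ι-injective (trans (sym Lt≡u) (L≡ι𝟘 t t∈A))
    only-if : ∀ a b → (∃[ x ] (x ∈ A × InBox a b x)) → All (NonNegAt (interleave a b)) (feasibility ++ 𝟘-tests)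
    only-if a b h = AllL.++⁺ (from (feasibility⇔ _) (proj₁ reduced))
                             (from (𝟘-tests⇔ _) (𝟘-in (proj₂ reduced)))
      where
      reduced : Feasible (interleave a b) × (∃[ u ] (u ∈ L-image v A × InReducedBox (interleave a b) u))
      reduced = to (box⇔reducedBox a b) h
      𝟘-in : (∃[ u ] (u ∈ L-image v A × InReducedBox (interleave a b) u)) → InReducedBox (interleave a b) 𝟘
      𝟘-in (u , u∈image , u∈) = subst (InReducedBox (interleave a b)) (image≡𝟘 u u∈image) u∈
    if : ∀ a b → All (NonNegAt (interleave a b)) (feasibility ++ 𝟘-tests) → ∃[ x ] (x ∈ A × InBox a b x)
    if a b h = from (box⇔reducedBox a b)
      (to (feasibility⇔ _) (AllL.++⁻ˡ feasibility h) ,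
       𝟘 , (𝟘 , 𝟘-mem , L≡ι𝟘 𝟘 𝟘-mem) , to (𝟘-tests⇔ _) (AllL.++⁻ʳ feasibility h))

  -- Composing the recursive tests with the reduced bounds raises their order by one; the
  -- feasibility tests have order 1 and are lifted to match.
  criterion-image : ∀ {r} → Criterion (L-image v A) (suc r) → Criterion A (suc (suc r))
  criterion-image {r} (E , E-linear , E-correct) =
    feasibility ++ List.map (_∘ reducedBounds) E ,
    AllL.++⁺ (AllL.map (λ p → ModLinear-1≤ p (suc r)) feasibility-linear)
             (AllL.map⁺ (AllL.map (ModLinear-∘ reducedBounds-floors) E-linear)) ,
    λ a b a≤b → mk⇔ (only-if a b a≤b) (if a b a≤b)
    where
    only-if : ∀ a b → (∀ i → lookup a i ≤ lookup b i) → (∃[ x ] (x ∈ A × InBox a b x)) →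
              All (NonNegAt (interleave a b)) (feasibility ++ List.map (_∘ reducedBounds) E)
    only-if a b a≤b h = AllL.++⁺
      (from (feasibility⇔ _) (proj₁ reduced))
      (AllL.map⁺ (to (E-correct _ _ (reducedBox-ordered a b a≤b (proj₁ reduced))) (proj₂ reduced)))
      where
      reduced : Feasible (interleave a b) × (∃[ u ] (u ∈ L-image v A × InReducedBox (interleave a b) u))
      reduced = to (box⇔reducedBox a b) h
    if : ∀ a b → (∀ i → lookup a i ≤ lookup b i) →
         All (NonNegAt (interleave a b)) (feasibility ++ List.map (_∘ reducedBounds) E) →
         ∃[ x ] (x ∈ A × InBox a b x)
    if a b a≤b h = from (box⇔reducedBox a b)
      (feas , from (E-correct _ _ (reducedBox-ordered a b a≤b feas)) (AllL.map⁻ (AllL.++⁻ʳ feasibility h)))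
      where
      feas : Feasible (interleave a b)
      feas = to (feasibility⇔ _) (AllL.++⁻ˡ feasibility h)

-- Induction on membership in the class, with the rank bound falling at each step. Bound 0 is
-- impossible because `A` is nonzero, and bound 1 with a nonzero image is impossible because that
-- image would get bound 0.
criterion : ∀ {ℓ} {A : Pred (Vec ℤ n) ℓ} → 𝓔 A → ∀ r → Dependent A (suc r) → Criterion A r
criterion A∈𝓔 zero dep = ⊥-elim (𝓔⇒rank≢0 A∈𝓔 dep)
criterion (mk sub v v∈A _ v∣A (inj₁ L≡0)) (suc r) _ = criterion-𝟘 sub v v∈A v∣A L≡0 r
criterion (mk sub v v∈A v≢𝟘 v∣A (inj₂ image∈𝓔)) 1 dep =
  ⊥-elim (𝓔⇒rank≢0 image∈𝓔 (dependent-image v v≢𝟘 v∣A v∈A dep))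
criterion (mk sub v v∈A v≢𝟘 v∣A (inj₂ image∈𝓔)) (suc (suc r)) dep =
  criterion-image sub v v∈A v∣A (criterion image∈𝓔 (suc r) (dependent-image v v≢𝟘 v∣A v∈A dep))

mainTheorem1 : ∀ {ℓ} (n : ℕ) → 1 ℕ.≤ n →
  (A : Pred (Vec ℤ n) ℓ) → 𝓔 A → (r : ℕ) → HasRank A r →
  Σ[ E ∈ List (Vec ℤ (n ℕ.* 2) → ℤ) ] (All (ModLinear r) E ×
    (∀ (a b : Vec ℤ n) → (∀ i → lookup a i ≤ lookup b i) →
      (∃[ x ] (x ∈ A × (∀ i → lookup a i ≤ lookup x i × lookup x i ≤ lookup b i)))
      ⇔ All (λ l → 0ℤ ≤ l (interleave a b)) E))
mainTheorem1 n _ A A∈𝓔 r (_ , dependent) = criterion A∈𝓔 r dependent
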